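{- There is an algorithm that maps any instance $(\mathcal{G},k,\ell)$ of Multistage Vertex Cover in $O(|V(\mathcal{G})|^2\tau)$ time to an equivalent instance $(\mathcal{G}',k,\ell)$ of Multistage Vertex Cover such that $\mathcal{G}'$ has at most $2k^2\tau(\mathcal{G})$ vertices and at most $k^2\tau(\mathcal{G})$ temporal edges.
   Context: A temporal graph $\mathcal{G}=(V,\mathcal{E},\tau)$ consists of a finite vertex set $V=V(\mathcal{G})$, a time horizon $\tau=\tau(\mathcal{G})\in\mathbb{N}$ and a set of temporal edges $\mathcal{E}\subseteq\binom{V}{2}\times\{1,\dots,\tau\}$; equivalently a sequence of layers $(G_1,\dots,G_\tau)$ with $G_t=(V,\{e:(e,t)\in\mathcal{E}\})$. Multistage Vertex Cover: given $\mathcal{G}$ and integers $k\in\mathbb{N}$, $\ell\in\mathbb{N}_0$, decide whether there is $(S_1,\dots,S_\tau)$ with each $S_i\subseteq V$ a vertex cover of $G_i$ of size at most $k$ and $|S_i\triangle S_{i+1}|\le\ell$ for all $i<\tau$ ($\triangle$ = symmetric difference). Two instances are equivalent if both are yes-instances or both are no-instances.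
   Formalization: The bounds on vertices and temporal edges are asserted only when not both k=1 and τ=1: with k=τ=1 they allow a single temporal edge, always a yes-instance, while two disjoint edges in one layer form a no-instance. Time and equivalence hold for all k≥1. -}

module Defs where

open import Data.Fin as Fin using (Fin; toℕ)
open import Data.Fin.Subset as Subset using (Subset; ∣_∣; _∪_; _─_)
open import Data.List using (List; []; _∷_; map; length)
open import Data.List.Membership.Propositional using (_∈_)
open import Data.List.Relation.Unary.All using (All)
open import Data.List.Relation.Unary.Unique.Propositional using (Unique)
open import Data.Nat using (ℕ; zero; suc; _+_; _∸_; _≤_; _<_; _≟_)
open import Data.Product using (_×_; _,_; ∃-syntax)
open import Data.Sum using (_⊎_)
open import Data.Vec using (Vec; lookup)
open import Relation.Binary.PropositionalEquality using (_≡_)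
open import Relation.Nullary using (¬_; yes; no)

-- The vertex set is Fin n and the times 1, …, τ are the elements of Fin τ.
-- A finite set of temporal edges is a duplicate-free list, in which the
-- temporal edge ({u , v} , t) is the triple (u , v , t) with u < v.
record TemporalGraph : Set where
  field
    n τ           : ℕ
    τ-positive    : 1 ≤ τ
    edges         : List (Fin n × Fin n × Fin τ)
    edges-ordered : All (λ (u , v , t) → u Fin.< v) edges
    edges-unique  : Unique edges

  Layer : Fin τ → Fin n → Fin n → Set
  Layer t u v = (u , v , t) ∈ edges ⊎ (v , u , t) ∈ edges

  ∣V∣ : ℕ
  ∣V∣ = n

  ∣ℰ∣ : ℕ
  ∣ℰ∣ = length edges

open TemporalGraph public

IsVertexCover : ∀ {n} → (Fin n → Fin n → Set) → Subset n → Set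
IsVertexCover Adj S = ∀ u v → Adj u v → u Subset.∈ S ⊎ v Subset.∈ S

infixl 5 _△_

_△_ : ∀ {n} → Subset n → Subset n → Subset n
S △ T = (S ─ T) ∪ (T ─ S)

-- The triple (G , k , ℓ).
Instance : Set
Instance = TemporalGraph × ℕ × ℕ

YesInstance : Instance → Set
YesInstance (G , k , ℓ) =
  ∃[ S ] ((t : Fin (τ G)) →
            IsVertexCover (Layer G t) (lookup S t) × ∣ lookup S t ∣ ≤ k)
       × ((i j : Fin (τ G)) → toℕ j ≡ suc (toℕ i) →
            ∣ lookup {A = Subset (n G)} S i △ lookup S j ∣ ≤ ℓ)

Equivalent : Instance → Instance → Set
Equivalent I J = (YesInstance I × YesInstance J)
               ⊎ (¬ YesInstance I × ¬ YesInstance J)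

-- Structured programs over a random access machine with the uniform cost
-- measure.  A program names finitely many scalar variables and finitely many
-- one-dimensional arrays, all holding natural numbers; interleaving the
-- arrays turns this into a single linear memory at constant-factor cost.
-- Addition and truncated subtraction are the only arithmetic instructions
-- (no multiplication), so that uniform cost is a realistic measure.

Var Arr : Set
Var = ℕ
Arr = ℕ

infixr 7 _‼_
infixl 6 _⊕_ _⊖_
infix  4 _≺_ _≐_
infix  3 _≔_ _[_]≔_
infixr 2 _⨾_

data Exp : Set where
  lit     : ℕ → Exp
  var     : Var → Exp
  _‼_     : Arr → Exp → Exp
  _⊕_ _⊖_ : Exp → Exp → Exp

data Test : Set where
  _≺_ _≐_ : Exp → Exp → Test

data Program : Set where
  skip          : Program
  _≔_           : Var → Exp → Program
  _[_]≔_        : Arr → Exp → Exp → Program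
  _⨾_           : Program → Program → Program
  if_then_else_ : Test → Program → Program → Program
  while_loop_   : Test → Program → Program

record Store : Set where
  constructor store
  field
    reg : Var → ℕ
    arr : Arr → ℕ → ℕ

open Store public

infixl 9 _[_↦_]

_[_↦_] : ∀ {A : Set} → (ℕ → A) → ℕ → A → ℕ → A
(f [ x ↦ a ]) y with x ≟ y
... | yes _ = a
... | no  _ = f y

eval : Exp → Store → ℕ
eval (lit c)   s = c
eval (var x)   s = reg s x
eval (a ‼ e)   s = arr s a (eval e s)
eval (e ⊕ f)   s = eval e s + eval f s
eval (e ⊖ f)   s = eval e s ∸ eval f s

Holds : Test → Store → Set
Holds (e ≺ f) s = eval e s < eval f s
Holds (e ≐ f) s = eval e s ≡ eval f s

cost : Exp → ℕ
cost (lit c)   = 1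
cost (var x)   = 1
cost (a ‼ e)   = 1 + cost e
cost (e ⊕ f)   = 1 + cost e + cost f
cost (e ⊖ f)   = 1 + cost e + cost f

costᵗ : Test → ℕ
costᵗ (e ≺ f) = 1 + cost e + cost f
costᵗ (e ≐ f) = 1 + cost e + cost f

infix 1 ⟨_,_⟩⇓[_]_

-- ⟨ P , s ⟩⇓[ T ] s′ : started in s, the program P halts in s′ after T steps.
data ⟨_,_⟩⇓[_]_ : Program → Store → ℕ → Store → Set where

  ⇓skip   : ∀ {s} → ⟨ skip , s ⟩⇓[ 1 ] s

  ⇓assign : ∀ {x e s} →
            ⟨ x ≔ e , s ⟩⇓[ 1 + cost e ]
              store (reg s [ x ↦ eval e s ]) (arr s)

  ⇓write  : ∀ {a e f s} →
            ⟨ a [ e ]≔ f , s ⟩⇓[ 1 + cost e + cost f ]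
              store (reg s) (arr s [ a ↦ arr s a [ eval e s ↦ eval f s ] ])

  ⇓seq    : ∀ {P Q s s′ s″ T U} →
            ⟨ P , s ⟩⇓[ T ] s′ → ⟨ Q , s′ ⟩⇓[ U ] s″ →
            ⟨ P ⨾ Q , s ⟩⇓[ T + U ] s″

  ⇓then   : ∀ {b P Q s s′ T} →
            Holds b s → ⟨ P , s ⟩⇓[ T ] s′ →
            ⟨ if b then P else Q , s ⟩⇓[ costᵗ b + T ] s′

  ⇓else   : ∀ {b P Q s s′ T} →
            ¬ Holds b s → ⟨ Q , s ⟩⇓[ T ] s′ →
            ⟨ if b then P else Q , s ⟩⇓[ costᵗ b + T ] s′

  ⇓stop   : ∀ {b P s} →
            ¬ Holds b s → ⟨ while b loop P , s ⟩⇓[ costᵗ b ] s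

  ⇓loop   : ∀ {b P s s′ s″ T U} →
            Holds b s → ⟨ P , s ⟩⇓[ T ] s′ → ⟨ while b loop P , s′ ⟩⇓[ U ] s″ →
            ⟨ while b loop P , s ⟩⇓[ costᵗ b + T + U ] s″

at : List ℕ → ℕ → ℕ
at []       _       = 0
at (x ∷ xs) zero    = x
at (x ∷ xs) (suc i) = at xs i

-- Variables 0 to 4 hold |V|, τ, k, ℓ and |ℰ|.  For i < |ℰ|, the i-th entries
-- of the arrays 0, 1 and 2 are the two endpoints and the time of the i-th
-- temporal edge.  Everything else is initially 0.
load : Instance → Store
load (G , k , ℓ) = store regs arrs
  where
  regs : Var → ℕ
  regs 0 = ∣V∣ G
  regs 1 = τ G
  regs 2 = k
  regs 3 = ℓ
  regs 4 = ∣ℰ∣ G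
  regs _ = 0

  arrs : Arr → ℕ → ℕ
  arrs 0 = at (map (λ (u , v , t) → toℕ u) (edges G))
  arrs 1 = at (map (λ (u , v , t) → toℕ v) (edges G))
  arrs 2 = at (map (λ (u , v , t) → toℕ t) (edges G))
  arrs _ = λ _ → 0

-- An output may leave arbitrary values in the cells the encoding does not use.
_encodes_ : Store → Instance → Set
s encodes I@(G , _ , _) =
    (∀ x → x < 5 → reg s x ≡ reg (load I) x)
  × (∀ a i → a < 3 → i < ∣ℰ∣ G → arr s a i ≡ arr (load I) a i)

infix 3 _maps_to_within_

_maps_to_within_ : Program → Instance → Instance → ℕ → Set
P maps I to J within B =
  ∃[ T ] ∃[ s ] (⟨ P , load I ⟩⇓[ T ] s) × s encodes J × T ≤ B

{-# OPTIONS --safe #-}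

-- In a layer t, a vertex of degree more than k belongs to every cover of size
-- at most k.  Replacing all edges at such a vertex v by one pendant edge from v
-- to a fresh vertex therefore keeps the solutions: a solution of G also covers
-- the new edges, and conversely identifying every fresh vertex with its
-- neighbour, which increases neither sizes nor symmetric differences, turns a
-- solution of the new instance into one of G.  Afterwards every edge of a layer
-- meets one of the at most k vertices of a cover, each of degree at most k, so
-- more than k²τ edges witness a no-instance, for which a matching with k + 1
-- edges is returned.  Vertices are numbered when they first occur in an emitted
-- edge, so there are at most twice as many of them as edges.
module Submission where

open import Defs
open import Data.Empty using (⊥)
open import Data.Fin as Fin using (Fin; toℕ; zero; suc)
import Data.Fin.Properties as Fin
open import Data.Fin.Subset as Subset using (Subset; inside; outside; ∣_∣; _∪_; ⁅_⁆)
import Data.Fin.Subset.Properties as Subset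
open import Data.List using (List; []; _∷_; _∷ʳ_; map; length; filter; concatMap; allFin; reverse; _ʳ++_; cartesianProduct; applyDownFrom; replicate)
open import Data.List.Properties using (length-++; length-map; length-tabulate; length-replicate; length-applyDownFrom; unfold-reverse; length-reverse; length-ʳ++; filter-accept; filter-reject; reverse-map; map-∘)
open import Data.List.Membership.Propositional using (_∈_; _∉_; find; lose)
open import Data.List.Membership.Propositional.Properties using (∈-map⁺; ∈-map⁻; ∈-filter⁻; ∈-concatMap⁺; ∈-cartesianProduct⁺; ∈-allFin; ∈-applyDownFrom⁻)
import Data.List.Membership.DecPropositional as DecMembership
open import Data.List.Relation.Unary.All as All using (All; []; _∷_)
import Data.List.Relation.Unary.All.Properties as All
open import Data.List.Relation.Unary.AllPairs as AllPairs using (AllPairs; []; _∷_)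
open import Data.List.Relation.Unary.Any as Any using (Any; here; there)
import Data.List.Relation.Unary.Any.Properties as Any
open import Data.List.Relation.Unary.Unique.Propositional using (Unique)
import Data.List.Relation.Unary.Unique.Propositional.Properties as Unique
open import Data.Nat
open import Data.Nat.ListAction using (sum)
open import Data.Nat.Properties
open import Data.Product using (_×_; _,_; ∃-syntax; proj₁; proj₂)
open import Data.Product.Properties using () renaming (≡-dec to ×-≡-dec)
open import Data.Sum as Sum using (_⊎_; inj₁; inj₂)
open import Data.Unit using (tt)
open import Data.Vec as Vec using (Vec; []; _∷_; lookup; here; there)
import Data.Vec.Properties as Vec
open import Function using (_∘_; id)
open import Relation.Binary using (DecidableEquality; tri<; tri≈; tri>)
open import Relation.Binary.PropositionalEquality
open import Relation.Nullary using (¬_; Dec; yes; no; contradiction; _×-dec_; _⊎-dec_; _→-dec_; map′)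
open import Relation.Unary using (Decidable)

-- The running time may not depend on `k`, although the limit k²τ does and products must be formed
-- by repeated addition. Each of the m input edges causes at most three emissions: a pendant edge at
-- either end and a copy of itself. So at most 3m edges are ever written, and the limit may use
-- min(k, 3m) instead of k. If k ≥ 3m, the limit is at least 3m and is never exceeded; otherwise the
-- minimum is k itself, and the k + 1 steps that write the matching are affordable too. One pass
-- over the edges suffices because the degrees are tabulated beforehand and an entry is reset to 0
-- once its vertex has a pendant edge; an end point of an edge that has not been reset always has a
-- positive entry. The matching respects the size bounds when k + 1 ≤ k²τ, which for positive k and
-- τ fails only at k = τ = 1. There the bounds allow a single edge; one of its ends, chosen in every
-- layer, is a solution, so no no-instance is that small. This is why the size bounds exclude this
-- case. The summand 1 in the time bound pays for the constant work on a graph without vertices.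

private variable
  A C : Set
  M N T k ℓ : ℕ
  G G′ : TemporalGraph

-- Counting in lists

opaque

  -- Opaque, so that degrees do not unfold into filtered lists in goals; other code reasons through
  -- the equations that follow.
  count : {P : A → Set} → Decidable P → List A → ℕ
  count P? xs = length (filter P? xs)

module _ {P : A → Set} (P? : Decidable P) where

  opaque
    unfolding count

    count-filter : ∀ xs → count P? xs ≡ length (filter P? xs)
    count-filter xs = refl

    count-[] : count P? [] ≡ 0
    count-[] = refl

    count-accept : ∀ {x xs} → P x → count P? (x ∷ xs) ≡ suc (count P? xs)
    count-accept px = cong length (filter-accept P? px)

    count-reject : ∀ {x xs} → ¬ P x → count P? (x ∷ xs) ≡ count P? xs
    count-reject ¬px = cong length (filter-reject P? ¬px)

  count-∷ : ∀ x xs → count P? xs ≤ count P? (x ∷ xs)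
  count-∷ x xs with P? x
  ... | yes px rewrite count-accept {x} {xs} px = n≤1+n _
  ... | no ¬px rewrite count-reject {x} {xs} ¬px = ≤-refl

  count-positive : ∀ {xs} → Any P xs → 0 < count P? xs
  count-positive {x ∷ xs} (here px) rewrite count-accept {x} {xs} px = s≤s z≤n
  count-positive {x ∷ xs} (there p) = ≤-trans (count-positive p) (count-∷ x xs)

  count-ʳ++ : ∀ xs ys → count P? (xs ʳ++ ys) ≡ count P? xs + count P? ys
  count-ʳ++ [] ys = cong (_+ count P? ys) (sym count-[])
  count-ʳ++ (x ∷ xs) ys with P? x
  ... | yes px = trans (count-ʳ++ xs (x ∷ ys)) (trans (cong (count P? xs +_) (count-accept px))
                   (trans (+-suc _ _) (cong (_+ count P? ys) (sym (count-accept px)))))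
  ... | no ¬px = trans (count-ʳ++ xs (x ∷ ys))
        (cong₂ _+_ (sym (count-reject ¬px)) (count-reject ¬px))

  count-reverse : ∀ xs → count P? (reverse xs) ≡ count P? xs
  count-reverse xs = trans (count-ʳ++ xs [])
      (trans (cong (count P? xs +_) count-[]) (+-identityʳ _))

all-equal⇒length≤1 : ∀ {xs : List A} → Unique xs → (∀ {x y} → x ∈ xs → y ∈ xs → x ≡ y) →
    length xs ≤ 1
all-equal⇒length≤1 {xs = []}         _ _ = z≤n
all-equal⇒length≤1 {xs = _ ∷ []}     _ _ = ≤-refl
all-equal⇒length≤1 {xs = x ∷ y ∷ _} ((x≢y ∷ _) ∷ _) eq =
  contradiction (eq (here refl) (there (here refl))) x≢y

count≤1 : ∀ {P : A → Set} (P? : Decidable P) {xs} → Unique xs →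
          (∀ {x y} → x ∈ xs → y ∈ xs → P x → P y → x ≡ y) → count P? xs ≤ 1
count≤1 P? {xs} uniq eq = subst (_≤ 1) (sym (count-filter P? xs))
    (all-equal⇒length≤1 (Unique.filter⁺ P? uniq) λ x∈ y∈ →
  let x∈xs , px = ∈-filter⁻ P? {xs = xs} x∈
      y∈xs , py = ∈-filter⁻ P? {xs = xs} y∈
  in eq x∈xs y∈xs px py)

module _ {R : C → A → Set} (R? : ∀ s → Decidable (R s)) where

  sum-counts-∷ : ∀ x xs slots → sum (map (λ s → count (R? s) xs) slots)
      ≤ sum (map (λ s → count (R? s) (x ∷ xs)) slots)
  sum-counts-∷ x xs []          = z≤n
  sum-counts-∷ x xs (s ∷ slots) = +-mono-≤ (count-∷ (R? s) x xs) (sum-counts-∷ x xs slots)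

  sum-counts-< : ∀ {x} xs {slots} → Any (λ s → R s x) slots →
    sum (map (λ s → count (R? s) xs) slots) < sum (map (λ s → count (R? s) (x ∷ xs)) slots)
  sum-counts-< {x} xs {s ∷ slots} (here r) rewrite count-accept (R? s) {x} {xs} r =
      s≤s (+-monoʳ-≤ _ (sum-counts-∷ x xs slots))
  sum-counts-< {x} xs {s ∷ slots} (there r) = +-mono-≤-< (count-∷ (R? s) x xs) (sum-counts-< xs r)

  length≤sum-counts : ∀ {xs slots} → All (λ x → Any (λ s → R s x) slots) xs →
    length xs ≤ sum (map (λ s → count (R? s) xs) slots)
  length≤sum-counts []                   = z≤n
  length≤sum-counts {x ∷ xs} (r ∷ rs) = ≤-trans (s≤s (length≤sum-counts rs)) (sum-counts-< xs r)

  sum-counts≤ : ∀ {c xs slots} → (∀ {s} → s ∈ slots → count (R? s) xs ≤ c) →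
      sum (map (λ s → count (R? s) xs) slots) ≤ length slots * c
  sum-counts≤ {slots = []}    bound = z≤n
  sum-counts≤ {xs = xs} {_ ∷ _} bound =
      +-mono-≤ (bound (here refl)) (sum-counts≤ {xs = xs} (bound ∘ there))

  -- Double counting: every entry is met by some slot, and every slot meets at most `c` entries. The
  -- degree argument, the k²τ bound, the bound on the input edges and the lower bound for covers of
  -- a matching are all instances.
  length≤slots*c : ∀ {c xs slots} → All (λ x → Any (λ s → R s x) slots) xs →
      (∀ {s} → s ∈ slots → count (R? s) xs ≤ c) → length xs ≤ length slots * c
  length≤slots*c {xs = xs} covered bound =
      ≤-trans (length≤sum-counts covered) (sum-counts≤ {xs = xs} bound)

length-concatMap-≤ : ∀ {c} (f : A → List C) → (∀ x → length (f x) ≤ c) → ∀ xs →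
    length (concatMap f xs) ≤ length xs * c
length-concatMap-≤ f bound []       = z≤n
length-concatMap-≤ f bound (x ∷ xs) = ≤-trans (≤-reflexive (length-++ (f x)))
  (+-mono-≤ (bound x) (length-concatMap-≤ f bound xs))

-- Subsets

elements : Subset N → List (Fin N)
elements []            = []
elements (inside ∷ S)  = zero ∷ map suc (elements S)
elements (outside ∷ S) = map suc (elements S)

length-elements : (S : Subset N) → length (elements S) ≡ ∣ S ∣
length-elements []            = refl
length-elements (inside ∷ S)  = cong suc (trans (length-map suc (elements S)) (length-elements S))
length-elements (outside ∷ S) = trans (length-map suc (elements S)) (length-elements S)

∈-elements⁺ : ∀ {S : Subset N} {v} → v Subset.∈ S → v ∈ elements S
∈-elements⁺ {S = inside ∷ S} here               = here refl
∈-elements⁺ {S = inside ∷ S} (there v∈S)        = there (∈-map⁺ suc (∈-elements⁺ v∈S))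
∈-elements⁺ {S = outside ∷ S} (there v∈S)       = ∈-map⁺ suc (∈-elements⁺ v∈S)

∈-elements⁻ : ∀ (S : Subset N) {v} → v ∈ elements S → v Subset.∈ S
∈-elements⁻ (inside ∷ S)  (here refl) = here
∈-elements⁻ (inside ∷ S)  (there v∈) with w , w∈ , refl ← ∈-map⁻ suc v∈ = there (∈-elements⁻ S w∈)
∈-elements⁻ (outside ∷ S) v∈         with w , w∈ , refl ← ∈-map⁻ suc v∈ = there (∈-elements⁻ S w∈)

∣p∪q∣≤∣p∣+∣q∣ : (p q : Subset N) → ∣ p ∪ q ∣ ≤ ∣ p ∣ + ∣ q ∣
∣p∪q∣≤∣p∣+∣q∣ []            []            = z≤n
∣p∪q∣≤∣p∣+∣q∣ (outside ∷ p) (outside ∷ q) = ∣p∪q∣≤∣p∣+∣q∣ p q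
∣p∪q∣≤∣p∣+∣q∣ (outside ∷ p) (inside ∷ q)  rewrite +-suc ∣ p ∣ ∣ q ∣ = s≤s (∣p∪q∣≤∣p∣+∣q∣ p q)
∣p∪q∣≤∣p∣+∣q∣ (inside ∷ p)  (outside ∷ q) = s≤s (∣p∪q∣≤∣p∣+∣q∣ p q)
∣p∪q∣≤∣p∣+∣q∣ (inside ∷ p)  (inside ∷ q)  rewrite +-suc ∣ p ∣ ∣ q ∣ =
    s≤s (m≤n⇒m≤1+n (∣p∪q∣≤∣p∣+∣q∣ p q))

-- The subset {b} if x = 1 + b, and the empty set if x codes no element.
decode : ∀ N → ℕ → Subset N
decode N zero = Subset.⊥
decode N (suc b) with b <? N
... | yes b<N = ⁅ Fin.fromℕ< b<N ⁆
... | no  _   = Subset.⊥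

decode-∈⁺ : ∀ {x} (b : Fin N) → x ≡ suc (toℕ b) → b Subset.∈ decode N x
decode-∈⁺ {N} b refl with toℕ b <? N
... | yes b<N rewrite Fin.fromℕ<-toℕ b b<N = Subset.x∈⁅x⁆ b
... | no  b≮N = contradiction (Fin.toℕ<n b) b≮N

decode-∈⁻ : ∀ x {b : Fin N} → b Subset.∈ decode N x → x ≡ suc (toℕ b)
decode-∈⁻ zero b∈ = contradiction b∈ Subset.∉⊥
decode-∈⁻ {N} (suc x) b∈ with x <? N
... | yes x<N rewrite Subset.x∈⁅y⁆⇒x≡y _ b∈ = cong suc (sym (Fin.toℕ-fromℕ< x<N))
... | no  _   = contradiction b∈ Subset.∉⊥

∣decode∣≤1 : ∀ x → ∣ decode N x ∣ ≤ 1
∣decode∣≤1 {N} zero rewrite Subset.∣⊥∣≡0 N = z≤n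
∣decode∣≤1 {N} (suc x) with x <? N
... | yes x<N = ≤-reflexive (Subset.∣⁅x⁆∣≡1 (Fin.fromℕ< x<N))
... | no  _   rewrite Subset.∣⊥∣≡0 N = z≤n

-- The image of a subset of Fin M under a partial function to Fin N, where
-- f a ≡ 1 + b stands for a ↦ b.
image : (Fin M → ℕ) → Subset M → Subset N
image f []            = Subset.⊥
image f (inside ∷ S)  = decode _ (f zero) ∪ image (f ∘ suc) S
image f (outside ∷ S) = image (f ∘ suc) S

∈-image⁺ : ∀ (f : Fin M → ℕ) {S a} {b : Fin N} → a Subset.∈ S → f a ≡ suc (toℕ b) →
    b Subset.∈ image f S
∈-image⁺ f {inside ∷ S}  here        eq = Subset.x∈p∪q⁺ (inj₁ (decode-∈⁺ _ eq))
∈-image⁺ f {inside ∷ S}  (there a∈S) eq =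
    Subset.x∈p∪q⁺ {p = decode _ (f zero)} (inj₂ (∈-image⁺ (f ∘ suc) a∈S eq))
∈-image⁺ f {outside ∷ S} (there a∈S) eq = ∈-image⁺ (f ∘ suc) a∈S eq

∈-image⁻ : ∀ (f : Fin M → ℕ) S {b : Fin N} → b Subset.∈ image f S →
    ∃[ a ] a Subset.∈ S × f a ≡ suc (toℕ b)
∈-image⁻ f [] b∈ = contradiction b∈ Subset.∉⊥
∈-image⁻ f (inside ∷ S) b∈ with Subset.x∈p∪q⁻ (decode _ (f zero)) (image (f ∘ suc) S) b∈
... | inj₁ b∈₁ = zero , here , decode-∈⁻ (f zero) b∈₁
... | inj₂ b∈₂ with a , a∈S , eq ← ∈-image⁻ (f ∘ suc) S b∈₂ = suc a , there a∈S , eq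
∈-image⁻ f (outside ∷ S) b∈ with a , a∈S , eq ← ∈-image⁻ (f ∘ suc) S b∈ = suc a , there a∈S , eq

∣image∣≤ : ∀ (f : Fin M → ℕ) S → ∣ image {N = N} f S ∣ ≤ ∣ S ∣
∣image∣≤ {N = N} f [] rewrite Subset.∣⊥∣≡0 N = z≤n
∣image∣≤ {N = N} f (inside ∷ S)  = ≤-trans (∣p∪q∣≤∣p∣+∣q∣ (decode N (f zero)) _)
  (+-mono-≤ (∣decode∣≤1 (f zero)) (∣image∣≤ (f ∘ suc) S))
∣image∣≤ f (outside ∷ S) = ∣image∣≤ (f ∘ suc) S

x∈p─q⇒x∉q : ∀ (p q : Subset N) {v} → v Subset.∈ p Subset.─ q → v Subset.∉ q
x∈p─q⇒x∉q (_ ∷ p) (inside ∷ q)  (there v∈) (there v∈q) = x∈p─q⇒x∉q p q v∈ v∈q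
x∈p─q⇒x∉q (_ ∷ p) (outside ∷ q) (there v∈) (there v∈q) = x∈p─q⇒x∉q p q v∈ v∈q

∈-△⁺ : ∀ {S T : Subset N} {v} → (v Subset.∈ S × v Subset.∉ T) ⊎ (v Subset.∈ T × v Subset.∉ S) →
    v Subset.∈ S △ T
∈-△⁺ (inj₁ (v∈S , v∉T)) = Subset.x∈p∪q⁺ (inj₁ (Subset.x∈p∧x∉q⇒x∈p─q v∈S v∉T))
∈-△⁺ {S = S} {T} (inj₂ (v∈T , v∉S)) =
    Subset.x∈p∪q⁺ {p = S Subset.─ T} (inj₂ (Subset.x∈p∧x∉q⇒x∈p─q v∈T v∉S))

-- A point in only one of the two images has a preimage in the corresponding set. This preimage
-- cannot lie in the other set, whose image would then contain the point.
image-△-⊆ : ∀ (f : Fin M → ℕ) S T → image {N = N} f S △ image f T Subset.⊆ image f (S △ T)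
image-△-⊆ f S T v∈ with Subset.x∈p∪q⁻ (image f S Subset.─ image f T) _ v∈
... | inj₁ v∈S─T with a , a∈S , eq ← ∈-image⁻ f S (Subset.p─q⊆p (image f S) _ v∈S─T) =
      ∈-image⁺ f (∈-△⁺ {S = S} (inj₁
          (a∈S , x∈p─q⇒x∉q (image f S) _ v∈S─T ∘ λ a∈T → ∈-image⁺ f a∈T eq))) eq
... | inj₂ v∈T─S with a , a∈T , eq ← ∈-image⁻ f T (Subset.p─q⊆p (image f T) _ v∈T─S) =
      ∈-image⁺ f (∈-△⁺ {S = S} (inj₂
          (a∈T , x∈p─q⇒x∉q (image f T) _ v∈T─S ∘ λ a∈S → ∈-image⁺ f a∈S eq))) eq

∣image-△∣≤ : ∀ (f : Fin M → ℕ) S T → ∣ image {N = N} f S △ image f T ∣ ≤ ∣ S △ T ∣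
∣image-△∣≤ f S T = ≤-trans (Subset.p⊆q⇒∣p∣≤∣q∣ (image-△-⊆ f S T)) (∣image∣≤ f (S △ T))

length-cartesianProduct : ∀ (xs : List A) (ys : List C) →
    length (cartesianProduct xs ys) ≡ length xs * length ys
length-cartesianProduct []       ys = refl
length-cartesianProduct (x ∷ xs) ys = trans (length-++ (map (x ,_) ys))
  (cong₂ _+_ (length-map (x ,_) ys) (length-cartesianProduct xs ys))

-- Degrees and covers

Edge : ℕ → ℕ → Set
Edge N T = Fin N × Fin N × Fin T

_≟ᵉ_ : DecidableEquality (Edge N T)
_≟ᵉ_ = ×-≡-dec Fin._≟_ (×-≡-dec Fin._≟_ Fin._≟_)

anyVec? : ∀ {P : Vec (Subset N) T → Set} → Decidable P → Dec (∃[ S ] P S)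
anyVec? {T = zero} P? = map′ (λ p → [] , p) (λ { ([] , p) → p }) (P? [])
anyVec? {T = suc T} P? = map′ (λ (A , S , p) → A ∷ S , p) (λ { (A ∷ S , p) → A , S , p })
  (Subset.anySubset? λ A → anyVec? λ S → P? (A ∷ S))

-- `Equivalent` is a disjunction, so two implications yield it only after a decision. Exhaustive
-- search over all tuples of subsets decides; it belongs to the proof and not to the program.
yesInstance? : Decidable YesInstance
yesInstance? (G , k , ℓ) = anyVec? λ S →
  (Fin.all? λ t →
     (Fin.all? λ u → Fin.all? λ v → (((u , v , t) ∈? edges G) ⊎-dec ((v , u , t) ∈? edges G))
        →-dec ((u Subset.∈? lookup S t) ⊎-dec (v Subset.∈? lookup S t)))
     ×-dec (∣ lookup S t ∣ ≤? k))
  ×-dec (Fin.all? λ i → Fin.all? λ j →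
      (toℕ j ≟ suc (toℕ i)) →-dec (∣ lookup S i △ lookup S j ∣ ≤? ℓ))
  where open DecMembership _≟ᵉ_

⇔⇒equivalent : ∀ {I J} → (YesInstance I → YesInstance J) → (YesInstance J → YesInstance I) →
    Equivalent I J
⇔⇒equivalent {I} to from with yesInstance? I
... | yes y = inj₁ (y , to y)
... | no ¬y = inj₂ (¬y , ¬y ∘ from)

Incident : Fin T → Fin N → Edge N T → Set
Incident t v (a , b , s) = s ≡ t × (a ≡ v ⊎ b ≡ v)

incident? : ∀ (t : Fin T) (v : Fin N) → Decidable (Incident t v)
incident? t v (a , b , s) = (s Fin.≟ t) ×-dec ((a Fin.≟ v) ⊎-dec (b Fin.≟ v))

degree : Fin T → Fin N → List (Edge N T) → ℕ
degree t v = count (incident? t v)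

-- Edges are stored with increasing end points, so two edges of a layer with
-- the same end points are equal.
count-common≤1 : ∀ {t} {v s : Fin (n G)} → s ≢ v →
                 count (incident? t s) (filter (incident? t v) (edges G)) ≤ 1
count-common≤1 {G} {t} {v} {s} s≢v =
  count≤1 (incident? t s) (Unique.filter⁺ (incident? t v) (edges-unique G)) λ x∈ y∈ ix iy →
    let x∈E , jx = ∈-filter⁻ (incident? t v) x∈
        y∈E , jy = ∈-filter⁻ (incident? t v) y∈
    in same x∈E y∈E jx ix jy iy
  where
  same : ∀ {x y} → x ∈ edges G → y ∈ edges G → Incident t v x → Incident t s x → Incident t v y →
      Incident t s y → x ≡ y
  same x∈ y∈ (refl , inj₁ refl) (_ , inj₁ refl) _ _ = contradiction refl s≢v
  same x∈ y∈ (refl , inj₂ refl) (_ , inj₂ refl) _ _ = contradiction refl s≢v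
  same x∈ y∈ _ _ (refl , inj₁ refl) (_ , inj₁ refl) = contradiction refl s≢v
  same x∈ y∈ _ _ (refl , inj₂ refl) (_ , inj₂ refl) = contradiction refl s≢v
  same x∈ y∈ (refl , inj₁ refl) (_ , inj₂ refl) (refl , inj₁ refl) (_ , inj₂ refl) = refl
  same x∈ y∈ (refl , inj₂ refl) (_ , inj₁ refl) (refl , inj₂ refl) (_ , inj₁ refl) = refl
  same x∈ y∈ (refl , inj₁ refl) (_ , inj₂ refl) (refl , inj₂ refl) (_ , inj₁ refl) =
    contradiction (All.lookup (edges-ordered G) x∈) (<-asym (All.lookup (edges-ordered G) y∈))
  same x∈ y∈ (refl , inj₂ refl) (_ , inj₁ refl) (refl , inj₁ refl) (_ , inj₂ refl) =
    contradiction (All.lookup (edges-ordered G) x∈) (<-asym (All.lookup (edges-ordered G) y∈))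

-- If `v` were missing from `S`, the other end point of each edge at `v` would lie in `S`. A vertex
-- other than `v` meets at most one of these edges, so `S` would have at least `degree t v`
-- elements.
high-degree⇒∈ : ∀ {S t v} → IsVertexCover (Layer G t) S → ∣ S ∣ ≤ k → k < degree t v (edges G) →
    v Subset.∈ S
high-degree⇒∈ {G} {k} {S} {t} {v} cover small high with v Subset.∈? S
... | yes v∈S = v∈S
... | no  v∉S = contradiction high (≤⇒≯ (begin
  degree t v (edges G)       ≡⟨ count-filter (incident? t v) (edges G) ⟩
  length (filter (incident? t v) (edges G)) ≤⟨ length≤slots*c (incident? t) (All.tabulate covered)
      (λ {s} s∈ → count-common≤1 {G} λ { refl → v∉S (∈-elements⁻ S s∈) }) ⟩
  length (elements S) * 1    ≡⟨ *-identityʳ _ ⟩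
  length (elements S)        ≡⟨ length-elements S ⟩
  ∣ S ∣                      ≤⟨ small ⟩
  k                          ∎))
  where
  open ≤-Reasoning
  covered : ∀ {e} → e ∈ filter (incident? t v) (edges G) → Any (λ s → Incident t s e) (elements S)
  covered {a , b , s} e∈ with ∈-filter⁻ (incident? t v) e∈
  ... | e∈E , refl , inj₁ refl with cover a b (inj₁ e∈E)
  ...   | inj₁ a∈S = contradiction a∈S v∉S
  ...   | inj₂ b∈S = Any.map (λ { refl → refl , inj₂ refl }) (∈-elements⁺ b∈S)
  covered {a , b , s} e∈ | e∈E , refl , inj₂ refl with cover a b (inj₁ e∈E)
  ...   | inj₁ a∈S = Any.map (λ { refl → refl , inj₁ refl }) (∈-elements⁺ a∈S)
  ...   | inj₂ b∈S = contradiction b∈S v∉S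

-- The slots are the pairs of a layer and a vertex of its cover, at most T · k in number. The list
-- need not come from a graph: it will consist of the kernel edges renamed by their labels, where a
-- pendant edge at `v` becomes the loop `(v , v , t)`.
covered-length≤ : ∀ {xs : List (Edge N T)} (S : Vec (Subset N) T) → (∀ t → ∣ lookup S t ∣ ≤ k) →
  All (λ (a , b , t) → a Subset.∈ lookup S t ⊎ b Subset.∈ lookup S t) xs →
  (∀ t v → degree t v xs ≤ k) → length xs ≤ k ^ 2 * T
covered-length≤ {N} {T} {k} {xs} S small covered sparse = begin
  length xs              ≤⟨ length≤slots*c (λ (t , v) → incident? t v) (All.map slot covered)
      (λ {(t , v)} _ → sparse t v) ⟩
  length slots * k       ≤⟨ *-monoˡ-≤ k (length-concatMap-≤ layer layer≤k (allFin T)) ⟩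
  length (allFin T) * k * k ≡⟨ cong (λ c → c * k * k) (length-tabulate {n = T} id) ⟩
  T * k * k              ≡⟨ *-assoc T k k ⟩
  T * (k * k)            ≡⟨ *-comm T (k * k) ⟩
  k * k * T              ≡⟨ cong (λ c → k * c * T) (*-identityʳ k) ⟨
  k ^ 2 * T              ∎
  where
  open ≤-Reasoning
  layer : Fin T → List (Fin T × Fin N)
  layer t = map (t ,_) (elements (lookup S t))
  layer≤k : ∀ t → length (layer t) ≤ k
  layer≤k t = ≤-trans (≤-reflexive
      (trans (length-map _ (elements (lookup S t))) (length-elements (lookup S t)))) (small t)
  slots = concatMap layer (allFin T)
  slot∈ : ∀ {t v} → v Subset.∈ lookup S t → (t , v) ∈ slots
  slot∈ {t} v∈ = ∈-concatMap⁺ layer {xs = allFin T}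
      (Any.map (λ { refl → ∈-map⁺ (t ,_) (∈-elements⁺ v∈) }) (∈-allFin t))
  slot : ∀ {e} → proj₁ e Subset.∈ lookup S (proj₂ (proj₂ e)) ⊎ proj₁ (proj₂ e) Subset.∈ lookup S
      (proj₂ (proj₂ e)) →
         Any (λ (t , v) → Incident t v e) slots
  slot (inj₁ a∈) = Any.map (λ { refl → refl , inj₁ refl }) (slot∈ a∈)
  slot (inj₂ b∈) = Any.map (λ { refl → refl , inj₂ refl }) (slot∈ b∈)

-- Converts running time linear in the number of temporal edges into the bound in terms of |V| and
-- τ.
∣ℰ∣≤ : ∀ G → ∣ℰ∣ G ≤ ∣V∣ G ^ 2 * τ G
∣ℰ∣≤ G = begin
  length (edges G)      ≤⟨ length≤slots*c (λ e → e ≟ᵉ_) {xs = edges G}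
      (All.tabulate λ { {a , b , t} _ →
                             Any.map sym (∈-cartesianProduct⁺ (∈-allFin a)
                                 (∈-cartesianProduct⁺ (∈-allFin b) (∈-allFin t))) })
                             (λ {s} _ → count≤1 (s ≟ᵉ_) {edges G} (edges-unique G) λ _ _ p q →
                                 trans (sym p) q) ⟩
  length slots * 1      ≡⟨ *-identityʳ _ ⟩
  length slots          ≡⟨ length-cartesianProduct (allFin (n G)) _ ⟩
  length (allFin (n G)) * length (cartesianProduct (allFin (n G)) (allFin (τ G)))
                        ≡⟨ cong₂ _*_ (length-tabulate {n = n G} id)
                            (trans (length-cartesianProduct (allFin (n G)) _)
                             (cong₂ _*_ (length-tabulate {n = n G} id)
                                 (length-tabulate {n = τ G} id))) ⟩
  n G * (n G * τ G)     ≡⟨ *-assoc (n G) (n G) (τ G) ⟨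
  n G * n G * τ G       ≡⟨ cong (λ c → n G * c * τ G) (*-identityʳ (n G)) ⟨
  n G ^ 2 * τ G         ∎
  where
  open ≤-Reasoning
  slots = cartesianProduct (allFin (n G)) (cartesianProduct (allFin (n G)) (allFin (τ G)))

-- Graphs given by lists of numbers

Arc : ℕ → Set
Arc T = ℕ × ℕ × Fin T

Below : ℕ → Arc T → Set
Below N (x , y , t) = x < y × y < N

toEdge : (a : Arc T) → Below N a → Edge N T
toEdge (x , y , t) (x<y , y<N) = Fin.fromℕ< (<-trans x<y y<N) , Fin.fromℕ< y<N , t

toArc : Edge N T → Arc T
toArc (u , v , t) = toℕ u , toℕ v , t

toArc-injective : ∀ {e f : Edge N T} → toArc e ≡ toArc f → e ≡ f
toArc-injective {e = u , v , t} {u′ , v′ , t′} eq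
  with refl ← Fin.toℕ-injective (cong proj₁ eq)
     | refl ← Fin.toℕ-injective (cong (proj₁ ∘ proj₂) eq)
     | refl ← cong (proj₂ ∘ proj₂) eq = refl

toEdges : {L : List (Arc T)} → All (Below N) L → List (Edge N T)
toEdges = All.reduce λ {a} → toEdge a

map-toArc-toEdges : ∀ {L : List (Arc T)} (below : All (Below N) L) → map toArc (toEdges below) ≡ L
map-toArc-toEdges [] = refl
map-toArc-toEdges {L = _ ∷ _} ((x<y , y<N) ∷ below) =
  cong₂ _∷_ (cong₂ _,_ (Fin.toℕ-fromℕ< _) (cong₂ _,_ (Fin.toℕ-fromℕ< _) refl))
      (map-toArc-toEdges below)

AllPairs-ʳ++ : ∀ {A : Set} {R : A → A → Set} → (∀ {x y} → R x y → R y x) →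
  ∀ {xs ys} → AllPairs R xs → AllPairs R ys → All (λ x → All (R x) ys) xs → AllPairs R (xs ʳ++ ys)
AllPairs-ʳ++ R-sym [] rys [] = rys
AllPairs-ʳ++ R-sym (rx ∷ rxs) rys (rxy ∷ rxys) = AllPairs-ʳ++ R-sym rxs (rxy ∷ rys)
  (All.zipWith (λ (r , rs) → R-sym r ∷ rs) (rx , rxys))

reverse-unique : ∀ {A : Set} {xs : List A} → Unique xs → Unique (reverse xs)
reverse-unique {xs = xs} uniq = AllPairs-ʳ++ ≢-sym uniq [] (All.universal (λ _ → []) xs)

module _ {L : List (Arc T)} (1≤T : 1 ≤ T) (below : All (Below N) L) (unique : Unique L) where

  -- `L` grows at its head while the program appends to arrays; the reversal makes the edge order
  -- agree with the store.
  graph : TemporalGraph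
  graph = record
    { n = N ; τ = T ; τ-positive = 1≤T
    ; edges = reverse (toEdges below)
    ; edges-ordered = All.tabulate λ e∈ → ordered below (Any.reverse⁻ {xs = toEdges below} e∈)
    ; edges-unique = reverse-unique
        (Unique.map⁻ (subst Unique (sym (map-toArc-toEdges below)) unique))
    }
    where
    ordered : ∀ {L : List (Arc T)} (below : All (Below N) L) {e : Edge N T} → e ∈ toEdges below →
        proj₁ e Fin.< proj₁ (proj₂ e)
    ordered ((x<y , y<N) ∷ _) (here refl) rewrite Fin.toℕ-fromℕ<
        (<-trans x<y y<N) | Fin.toℕ-fromℕ< y<N = x<y
    ordered (_ ∷ below)       (there e∈)  = ordered below e∈

  map-toArc-graph : map toArc (edges graph) ≡ reverse L
  map-toArc-graph = trans (reverse-map toArc (toEdges below))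
      (cong reverse (map-toArc-toEdges below))

  graph-∣ℰ∣ : ∣ℰ∣ graph ≡ length L
  graph-∣ℰ∣ = trans (sym (length-map toArc (edges graph)))
      (trans (cong length map-toArc-graph) (length-reverse L))

  graph-edge⁻ : ∀ {u v t} → (u , v , t) ∈ edges graph → (toℕ u , toℕ v , t) ∈ L
  graph-edge⁻ {u} {v} {t} e∈ = Any.reverse⁻ {xs = L}
      (subst ((toℕ u , toℕ v , t) ∈_) map-toArc-graph (∈-map⁺ toArc e∈))

  graph-edge⁺ : ∀ {a} → a ∈ L → ∃[ e ] e ∈ edges graph × a ≡ toArc e
  graph-edge⁺ {a} a∈ = ∈-map⁻ toArc (subst (a ∈_) (sym map-toArc-graph) (Any.reverse⁺ a∈))

-- Transporting solutions along vertex maps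

IsSolution : (G : TemporalGraph) → ℕ → ℕ → Vec (Subset (n G)) (τ G) → Set
IsSolution G k ℓ S = ((t : Fin (τ G)) → IsVertexCover (Layer G t) (lookup S t) × ∣ lookup S t ∣ ≤ k)
                   × ((i j : Fin (τ G)) → toℕ j ≡ suc (toℕ i) → ∣ lookup S i △ lookup S j ∣ ≤ ℓ)

-- Both directions of the equivalence take images under a vertex map. Sizes and symmetric
-- differences take care of themselves, so that only the covering condition is left to each
-- direction.
map-image : (f : Fin (n G) → ℕ) (S : Vec (Subset (n G)) (τ G)) → IsSolution G k ℓ S →
    (τ≡ : τ G ≡ τ G′) →
  (∀ t → IsVertexCover (Layer G′ (subst Fin τ≡ t)) (image f (lookup S t))) →
      YesInstance (G′ , k , ℓ)
map-image {G} {k} {ℓ} {G′} f S (ok , slow) refl cover = Vec.map (image f) S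
  , (λ t → subst (λ A → IsVertexCover (Layer G′ t) A × ∣ A ∣ ≤ k)
      (sym (Vec.lookup-map t (image f) S))
             (cover t , ≤-trans (∣image∣≤ f (lookup S t)) (proj₂ (ok t))))
  , (λ i j j≡1+i → subst₂ (λ A B → ∣ A △ B ∣ ≤ ℓ) (sym (Vec.lookup-map i (image f) S))
      (sym (Vec.lookup-map j (image f) S))
             (≤-trans (∣image-△∣≤ f (lookup S i) (lookup S j)) (slow i j j≡1+i)))

-- Every new vertex has a label, and ident v ≡ 1 + x makes x the representative
-- of v; ident v ≡ 0 means that v has none.
record Kernel (G : TemporalGraph) (k N : ℕ) (L : List (Arc (τ G))) : Set where
  field
    ident label : ℕ → ℕ
    below    : All (Below N) L
    unique   : Unique L
    sound    : All (λ (x , y , t) → ∃[ a ] ∃[ b ] ident (toℕ a) ≡ suc x ×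
                 (k < degree t a (edges G) ⊎ ident (toℕ b) ≡ suc y × Layer G t a b)) L
    complete : All (λ (u , v , t) → Any (λ (x , y , s) → s ≡ t ×
                 (label x ≡ toℕ u ⊎ label x ≡ toℕ v) × (label y ≡ toℕ u ⊎ label y ≡ toℕ v)) L)
                     (edges G)

  kernel : TemporalGraph
  kernel = graph (τ-positive G) below unique

  private
    Yes Yes′ : ℕ → Set
    Yes ℓ  = YesInstance (G , k , ℓ)
    Yes′ ℓ = YesInstance (kernel , k , ℓ)

  -- A kernel edge whose first end represents a vertex of high degree is covered by that end alone;
  -- any other kernel edge represents an edge of `G`, and a covering end there is mapped to a
  -- covering end here.
  to : ∀ {ℓ} → Yes ℓ → Yes′ ℓ
  to {ℓ} (S , ok , slow) = map-image {G = G} {G′ = kernel} f S (ok , slow) refl λ where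
      t u v (inj₁ e∈) → oriented (graph-edge⁻ (τ-positive G) below unique e∈)
      t u v (inj₂ e∈) → Sum.swap (oriented (graph-edge⁻ (τ-positive G) below unique e∈))
    where
    f : Fin (n G) → ℕ
    f = ident ∘ toℕ
    oriented : ∀ {t u v} → (toℕ u , toℕ v , t) ∈ L →
      u Subset.∈ image {N = N} f (lookup S t) ⊎ v Subset.∈ image f (lookup S t)
    oriented {t} e∈ with All.lookup sound e∈
    ... | a , b , ida , inj₁ high = inj₁
          (∈-image⁺ f (high-degree⇒∈ {G} (proj₁ (ok t)) (proj₂ (ok t)) high) ida)
    ... | a , b , ida , inj₂ (idb , adj) with proj₁ (ok t) a b adj
    ...   | inj₁ a∈ = inj₁ (∈-image⁺ f a∈ ida)
    ...   | inj₂ b∈ = inj₂ (∈-image⁺ f b∈ idb)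

  -- Each edge of `G` has a kernel edge in its layer both of whose ends are labelled by ends of that
  -- edge. Whichever end the cover contains, its label covers the edge of `G`.
  from : ∀ {ℓ} → Yes′ ℓ → Yes ℓ
  from {ℓ} (S , ok , slow) = map-image {G = kernel} {G′ = G} f S (ok , slow) refl λ where
      t u v (inj₁ e∈) → oriented e∈
      t u v (inj₂ e∈) → Sum.swap (oriented e∈)
    where
    f : Fin N → ℕ
    f = suc ∘ label ∘ toℕ
    member : ∀ {t u v x} → x Subset.∈ lookup S t → label (toℕ x) ≡ toℕ u ⊎ label (toℕ x) ≡ toℕ v →
      u Subset.∈ image {N = n G} f (lookup S t) ⊎ v Subset.∈ image f (lookup S t)
    member x∈ = Sum.map (λ eq → ∈-image⁺ f x∈ (cong suc eq)) (λ eq → ∈-image⁺ f x∈ (cong suc eq))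
    oriented : ∀ {t u v} → (u , v , t) ∈ edges G →
      u Subset.∈ image {N = n G} f (lookup S t) ⊎ v Subset.∈ image f (lookup S t)
    oriented {t} e∈
      with (x , y , s) , a∈L , refl , labx , laby ← find (All.lookup complete e∈)
      with (u′ , v′ , _) , e′∈ , refl ← graph-edge⁺ (τ-positive G) below unique a∈L
      with proj₁ (ok t) u′ v′ (inj₁ e′∈)
    ... | inj₁ u′∈ = member u′∈ labx
    ... | inj₂ v′∈ = member v′∈ laby

  equivalent : ∀ ℓ → Equivalent (G , k , ℓ) (kernel , k , ℓ)
  equivalent ℓ = ⇔⇒equivalent {G , k , ℓ} {kernel , k , ℓ} to from

-- Function updates and the matching used as no-instance

↦-same : ∀ (f : ℕ → A) i {x} → (f [ i ↦ x ]) i ≡ x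
↦-same f i with i ≟ i
... | yes _   = refl
... | no  i≢i = contradiction refl i≢i

↦-other : ∀ (f : ℕ → A) {i j x} → i ≢ j → (f [ i ↦ x ]) j ≡ f j
↦-other f {i} {j} i≢j with i ≟ j
... | yes i≡j = contradiction i≡j i≢j
... | no  _   = refl

rung : Fin T → ℕ → Arc T
rung t i = i + i , suc (i + i) , t

matching : Fin T → ℕ → List (Arc T)
matching t c = applyDownFrom (rung t) c

-- Halving sends the upper end of a rung to its index, as it does the lower end. Hence a vertex
-- determines its rung, and the rungs are pairwise disjoint.
⌊rung/2⌋ : ∀ i → ⌊ suc (i + i) /2⌋ ≡ i
⌊rung/2⌋ i = sym (n≡⌈n+n/2⌉ i)

matching-below : ∀ (t : Fin T) c → All (Below (c + c)) (matching t c)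
matching-below t c = All.applyDownFrom⁺₁ _ c λ {i} i<c →
    ≤-refl , subst (_≤ c + c) (cong suc (+-suc i i)) (+-mono-≤ i<c i<c)

matching-unique : ∀ (t : Fin T) c → Unique (matching t c)
matching-unique t c = Unique.applyDownFrom⁺₁ _ c λ {i} {j} j<i _ eq →
  <⇒≢ j<i (trans (sym (⌊rung/2⌋ j))
      (trans (cong ⌊_/2⌋ (sym (cong (proj₁ ∘ proj₂) eq))) (⌊rung/2⌋ i)))

module _ (1≤T : 1 ≤ T) (t : Fin T) (c : ℕ) where

  matchingGraph : TemporalGraph
  matchingGraph = graph 1≤T (matching-below t c) (matching-unique t c)

  -- All rungs lie in the single layer `t`, and no vertex covers two of them.
  matching-no : YesInstance (matchingGraph , k , ℓ) → c ≤ k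
  matching-no {k} (S , ok , _) = begin
    c                                  ≡⟨ length-applyDownFrom (rung t) c ⟨
    length (matching t c)              ≡⟨ graph-∣ℰ∣ 1≤T (matching-below t c) (matching-unique t c) ⟨
    length (edges matchingGraph)       ≤⟨ length≤slots*c (incident? t) {xs = edges matchingGraph}
        (All.tabulate λ e∈ → covered e∈)
                                            (λ {s} _ → count≤1 (incident? t s)
                                                (edges-unique matchingGraph) same) ⟩
    length (elements (lookup S t)) * 1 ≡⟨ *-identityʳ _ ⟩
    length (elements (lookup S t))     ≡⟨ length-elements (lookup S t) ⟩
    ∣ lookup S t ∣                     ≤⟨ proj₂ (ok t) ⟩
    k                                  ∎
    where
    open ≤-Reasoning
    position : ∀ {u v s} → (u , v , s) ∈ edges matchingGraph → ∃[ i ] toArc (u , v , s) ≡ rung t i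
    position e∈ with i , _ , eq ← ∈-applyDownFrom⁻ (rung t)
        (graph-edge⁻ 1≤T (matching-below t c) (matching-unique t c) e∈) = i , eq
    covered : ∀ {e} → e ∈ edges matchingGraph → Any (λ s → Incident t s e) (elements (lookup S t))
    covered {u , v , s} e∈ with refl ← cong (proj₂ ∘ proj₂) (proj₂ (position e∈))
        with proj₁ (ok t) u v (inj₁ e∈)
    ... | inj₁ u∈ = Any.map (λ { refl → refl , inj₁ refl }) (∈-elements⁺ u∈)
    ... | inj₂ v∈ = Any.map (λ { refl → refl , inj₂ refl }) (∈-elements⁺ v∈)
    half : ∀ e {s} i → toArc e ≡ rung t i → Incident t s e → ⌊ toℕ s /2⌋ ≡ i
    half e i eq (_ , inj₁ refl) = trans (cong (⌊_/2⌋ ∘ proj₁) eq) (sym (n≡⌊n+n/2⌋ i))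
    half e i eq (_ , inj₂ refl) = trans (cong (⌊_/2⌋ ∘ proj₁ ∘ proj₂) eq) (⌊rung/2⌋ i)
    same : ∀ {e f s} → e ∈ edges matchingGraph → f ∈ edges matchingGraph → Incident t s e →
        Incident t s f → e ≡ f
    same {e} {f} e∈ f∈ ie je with i , eqᵉ ← position e∈ | j , eqᶠ ← position f∈
        with refl ← trans (sym (half e i eqᵉ ie)) (half f j eqᶠ je) =
      toArc-injective (trans eqᵉ (sym eqᶠ))

-- The degree table

opaque

  -- The position of (t , v) in the row-major degree table.
  key : Fin T → Fin N → ℕ
  key {N = N} t v = toℕ t * N + toℕ v

  key≡ : ∀ (t : Fin T) (v : Fin N) → toℕ t * N + toℕ v ≡ key t v
  key≡ t v = refl

  -- `Fin.combine` is the same row-major numbering up to commuting the product, so its injectivity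
  -- carries over.
  key-injective : ∀ {t t′ : Fin T} {v v′ : Fin N} → key t v ≡ key t′ v′ → t ≡ t′ × v ≡ v′
  key-injective {T} {N} {t} {t′} {v} {v′} eq = Fin.combine-injective t v t′ v′ (Fin.toℕ-injective
    (trans (position t v) (trans eq (sym (position t′ v′)))))
    where
    position : ∀ (t : Fin T) (v : Fin N) → toℕ (Fin.combine t v) ≡ key t v
    position t v = trans (Fin.toℕ-combine t v) (cong (_+ toℕ v) (*-comm N (toℕ t)))

-- The two increments hit different entries because `u ≢ w`; a loop would be incremented twice but
-- counted once by `degree`.
degree-bump : ∀ {D : ℕ → ℕ} {u w : Fin N} {t : Fin T} {P p q} → u ≢ w → p ≡ key t u → q ≡ key t w →
  (∀ s v → D (key s v) ≡ degree s v P) → let D′ = D [ p ↦ suc (D p) ] in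
  ∀ s v → (D′ [ q ↦ suc (D′ q) ]) (key s v) ≡ degree s v ((u , w , t) ∷ P)
degree-bump {D = D} {u} {w} {t} {P} u≢w refl refl D≡ s v with incident? s v (u , w , t)
... | yes inc = trans (updated inc)
      (trans (cong suc (D≡ s v)) (sym (count-accept (incident? s v) inc)))
  where
  D′ = D [ key t u ↦ suc (D (key t u)) ]
  updated : Incident s v (u , w , t) →
      (D′ [ key t w ↦ suc (D′ (key t w)) ]) (key s v) ≡ suc (D (key s v))
  updated (refl , inj₁ refl) = trans (↦-other D′ (u≢w ∘ sym ∘ proj₂ ∘ key-injective))
      (↦-same D (key t u))
  updated (refl , inj₂ refl) = trans (↦-same D′ (key t w))
      (cong suc (↦-other D (u≢w ∘ proj₂ ∘ key-injective)))
... | no ¬inc = trans (↦-other _ (λ eq → let t≡s , w≡v = key-injective eq in ¬inc (t≡s , inj₂ w≡v)))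
        (trans (↦-other D (λ eq → let t≡s , u≡v = key-injective eq in ¬inc (t≡s , inj₁ u≡v)))
          (trans (D≡ s v) (sym (count-reject (incident? s v) ¬inc))))

-- A kernel edge together with the labels of its end points.
Item : ℕ → ℕ → Set
Item N T = Arc T × Fin N × Fin N

origin : Item N T → Edge N T
origin ((_ , _ , t) , a , b) = a , b , t

-- The invariant of the edge-by-edge construction

module _ (G : TemporalGraph) (k : ℕ) where

  private
    E = edges G
    V = Fin (n G)
    Time = Fin (τ G)

  Pendant : Time → V → Item (n G) (τ G) → Set
  Pendant t v ((_ , _ , s) , a , b) = s ≡ t × a ≡ v × b ≡ v

  Covers : Edge (n G) (τ G) → Item (n G) (τ G) → Set
  Covers (u , w , t) ((_ , _ , s) , a , b) = s ≡ t × (a ≡ u ⊎ a ≡ w) × (b ≡ u ⊎ b ≡ w)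

  -- d is the entry of the degree table at (t , v): the degree of v in layer t,
  -- until v receives its pendant edge and the entry is reset to 0.
  data Status (t : Time) (v : V) (d : ℕ) (out : List (Item (n G) (τ G)))
      (P : List (Edge (n G) (τ G))) : Set where
    -- Each case bounds the emitted edges at `(t , v)`: by 0, by the number of processed edges
    -- there, by 1. Once all edges are processed, each of these is at most `k` if `k` is positive. A
    -- pending vertex has no emitted edge because an edge is kept only after both its ends have been
    -- checked for high degree.
    pending : d ≡ degree t v E → k < d → degree t v (map origin out) ≡ 0 → Status t v d out P
    low     : d ≡ degree t v E → d ≤ k → degree t v (map origin out) ≤ degree t v P →
        Status t v d out P
    done    : d ≡ 0 → k < degree t v E → degree t v (map origin out) ≤ 1 → Any (Pendant t v) out →
        Status t v d out P

  -- Symmetric, since a kernel edge is oriented by the new numbers and may run opposite to the edge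
  -- it copies.
  Joins : List (Edge (n G) (τ G)) → Time → V → V → Set
  Joins P t a b = (a , b , t) ∈ P ⊎ (b , a , t) ∈ P

  data Sound (ident : ℕ → ℕ) (N : ℕ) (label : ℕ → ℕ) (P : List (Edge (n G) (τ G))) : Item (n G)
      (τ G) → Set where
    holds : ∀ {x y t a b} → x < y × y < N → label x ≡ toℕ a → label y ≡ toℕ b →
        ident (toℕ a) ≡ suc x →
      a ≡ b × k < degree t a E ⊎ ident (toℕ b) ≡ suc y × Joins P t a b →
      Sound ident N label P ((x , y , t) , a , b)

  -- State after processing the edges in `P`. `D` and `ident` will be arrays of the store and `N`
  -- the next free number, whereas `label` exists only in the proof. By `ids` it inverts `ident`,
  -- and it also names the neighbour of every fresh vertex.
  record Partial (D ident : ℕ → ℕ) (N : ℕ) (label : ℕ → ℕ) (out : List (Item (n G) (τ G)))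
      (P : List (Edge (n G) (τ G))) : Set where
    field
      ids     : ∀ (v : V) {x} → ident (toℕ v) ≡ suc x → x < N × label x ≡ toℕ v
      sound   : All (Sound ident N label P) out
      distinct : Unique (map proj₁ out)
      status  : ∀ (t : Time) (v : V) → Status t v (D (key t v)) out P
      covered : All (λ e → Any (Covers e) out) P

  open Partial

  module _ {ident ident′ : ℕ → ℕ} {N N′ : ℕ} {label label′ : ℕ → ℕ} {P P′ : List (Edge (n G) (τ G))}
    (ident≤ : ∀ (v : V) {x} → ident (toℕ v) ≡ suc x → ident′ (toℕ v) ≡ suc x) (N≤ : N ≤ N′)
    (label≡ : ∀ {x} → x < N → label′ x ≡ label x) (P⊆ : ∀ {e} → e ∈ P → e ∈ P′) where

    Sound-mono : ∀ {i} → Sound ident N label P i → Sound ident′ N′ label′ P′ i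
    Sound-mono (holds (x<y , y<N) la lb ia r) = holds
      (x<y , <-≤-trans y<N N≤) (trans (label≡ (<-trans x<y y<N)) la) (trans (label≡ y<N) lb)
          (ident≤ _ ia)
      (Sum.map₂ (λ (ib , j) → ident≤ _ ib , Sum.map P⊆ P⊆ j) r)

  fresh : ∀ {label : ℕ → ℕ} {z x} → x < N → (label [ N ↦ z ]) x ≡ label x
  fresh x<N = ↦-other _ (≢-sym (<⇒≢ x<N))

  module _ {D ident N label out P} (I : Partial D ident N label out P) where

    assign-step : ∀ (v : V) {i} → i ≡ toℕ v → ident i ≡ 0 →
        Partial D (ident [ i ↦ suc N ]) (suc N) (label [ N ↦ toℕ v ]) out P
    assign-step v refl new = record
      { ids = ids′
      ; sound = All.map (Sound-mono old (n≤1+n N) fresh id) (sound I)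
      ; distinct = distinct I ; status = status I ; covered = covered I }
      where
      ids′ : ∀ (w : V) {x} → (ident [ toℕ v ↦ suc N ]) (toℕ w) ≡ suc x →
          x < suc N × (label [ N ↦ toℕ v ]) x ≡ toℕ w
      ids′ w eq with v Fin.≟ w
      ids′ w eq | yes refl with refl ← trans (sym (↦-same ident (toℕ v) {suc N})) eq =
          n<1+n N , ↦-same label N
      ids′ w eq | no v≢w with x<N , lx ← ids I w
          (trans (sym (↦-other ident (v≢w ∘ Fin.toℕ-injective))) eq) =
          m<n⇒m<1+n x<N , trans (fresh x<N) lx
      old : ∀ (w : V) {x} → ident (toℕ w) ≡ suc x → (ident [ toℕ v ↦ suc N ]) (toℕ w) ≡ suc x
      old w eq = trans (↦-other ident λ v≡w →
          0≢1+n (trans (sym new) (trans (cong ident v≡w) eq))) eq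

    -- The fresh vertex `N` gets the label `v` but no entry of `ident`, so `x` remains the only
    -- representative of `v`. The new edge differs from all earlier ones because its upper end
    -- exceeds every number in use.
    pendant-step : ∀ {t : Time} {v : V} {x p} → p ≡ key t v → k < D p → ident (toℕ v) ≡ suc x →
      Partial (D [ p ↦ 0 ]) ident (suc N) (label [ N ↦ toℕ v ]) (((x , N , t) , v , v) ∷ out) P
    pendant-step {t} {v} {x} refl high iv = record
      { ids = λ w iw → let y<N , ly = ids I w iw in m<n⇒m<1+n y<N , trans (fresh y<N) ly
      ; sound = holds (x<N , n<1+n N) (trans (fresh x<N) lx) (↦-same label N) iv
          (inj₁ (refl , proj₁ highE))
              ∷ All.map (Sound-mono (λ _ → id) (n≤1+n N) fresh id) (sound I)
      ; distinct = All.map⁺ (All.map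
          (λ where (holds (_ , y<N) _ _ _ _) eq → <⇒≢ y<N (sym (cong (proj₁ ∘ proj₂) eq)))
          (sound I)) ∷ distinct I
      ; status = status′
      ; covered = All.map there (covered I) }
      where
      x<N = proj₁ (ids I v iv)
      lx  = proj₂ (ids I v iv)
      highE : k < degree t v E × degree t v (map origin out) ≡ 0
      highE with status I t v
      ... | pending eq _ none = subst (k <_) eq high , none
      ... | low _ ≤k _        = contradiction high (≤⇒≯ ≤k)
      ... | done ≡0 _ _ _     = contradiction (subst (k <_) ≡0 high) λ ()
      status′ : ∀ (s : Time) (w : V) →
          Status s w ((D [ key t v ↦ 0 ]) (key s w)) (((x , N , t) , v , v) ∷ out) P
      status′ s w with key t v ≟ key s w
      ... | yes eq with refl , refl ← key-injective {t = t} {s} {v} {w} eq =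
            done refl (proj₁ highE)
              (≤-reflexive (trans (count-accept (incident? t v) (refl , inj₁ refl))
                  (cong suc (proj₂ highE)))) (here (refl , refl , refl))
      ... | no neq with reject ← count-reject (incident? s w) {v , v , t} {map origin out}
            (λ { (refl , inj₁ refl) → neq refl ; (refl , inj₂ refl) → neq refl })
                   with status I s w
      ...   | pending eq hi none = pending eq hi (trans reject none)
      ...   | low eq lo ≤P       = low eq lo (≤-trans (≤-reflexive reject) ≤P)
      ...   | done ≡0 hi ≤1 p    = done ≡0 hi (≤-trans (≤-reflexive reject) ≤1) (there p)

    skip-step : ∀ {e} → Any (Covers e) out → Partial D ident N label out (e ∷ P)
    skip-step {e} cov = record
      { ids = ids I ; sound = All.map (Sound-mono (λ _ → id) ≤-refl (λ _ → refl) there) (sound I)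
      ; distinct = distinct I ; status = status′ ; covered = cov ∷ covered I }
      where
      status′ : ∀ (s : Time) (w : V) → Status s w (D (key s w)) out (e ∷ P)
      status′ s w with status I s w
      ... | pending eq hi none = pending eq hi none
      ... | low eq lo ≤P       = low eq lo (≤-trans ≤P (count-∷ (incident? s w) e P))
      ... | done ≡0 hi ≤1 p    = done ≡0 hi ≤1 p

    -- Zero is an unambiguous mark at an end point of an edge: a pending entry exceeds `k`, and a
    -- low entry equals a degree that `e` itself makes positive. So the vertex has its pendant edge,
    -- which stands in for `e`.
    reset⇒covered : ∀ {e} {t : Time} {v : V} → e ∈ E → Incident t v e → D (key t v) ≡ 0 →
        Any (Covers e) out
    reset⇒covered {e} {t} {v} e∈ inc ≡0 with status I t v
    ... | pending _ hi _ = contradiction (subst (k <_) ≡0 hi) λ ()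
    ... | low eq _ _     = contradiction
          (count-positive (incident? t v) (Any.map (λ { refl → inc }) e∈))
          (subst (λ d → ¬ 0 < d) (trans (sym ≡0) eq) λ ())
    ... | done _ _ _ p   = Any.map (λ {i} → cover {e} {i} inc) p
      where
      cover : ∀ {e : Edge (n G) (τ G)} {i} → Incident t v e → Pendant t v i → Covers e i
      cover (refl , inj₁ refl) (refl , refl , refl) = refl , inj₁ refl , inj₁ refl
      cover (refl , inj₂ refl) (refl , refl , refl) = refl , inj₂ refl , inj₂ refl

    -- Positive entries of at most `k` force the status `low` at both ends, where the emitted edge
    -- is paid for by the processed edge `e`. The pair `a`, `b` is `e` reordered by new numbers,
    -- hence the two cases for `e`.
    keep-step : ∀ {a b : V} {t : Time} {x y e} → e ≡ (a , b , t) ⊎ e ≡ (b , a , t) → e ∈ E →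
        (∀ {f} → f ∈ P → f ∈ E) → e ∉ P →
      (∀ (v : V) → Incident t v (a , b , t) → 0 < D (key t v) × D (key t v) ≤ k) →
      ident (toℕ a) ≡ suc x → ident (toℕ b) ≡ suc y → x < y →
      Partial D ident N label (((x , y , t) , a , b) ∷ out) (e ∷ P)
    keep-step {a} {b} {t} {x} {y} {e} e≡ e∈ P⊆ e∉ small ia ib x<y = record
      { ids = ids I
      ; sound = holds (x<y , proj₁ (ids I b ib)) (proj₂ (ids I a ia)) (proj₂ (ids I b ib)) ia
          (inj₂ (ib , Sum.map (here ∘ sym) (here ∘ sym) e≡))
              ∷ All.map (Sound-mono (λ _ → id) ≤-refl (λ _ → refl) there) (sound I)
      ; distinct = All.map⁺ (All.map new (sound I)) ∷ distinct I
      ; status = status′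
      ; covered = here (cover e≡) ∷ All.map there (covered I) }
      where
      a≢b : a ≢ b
      a≢b refl with refl ← trans (sym ia) ib = <-irrefl refl x<y
      cover : e ≡ (a , b , t) ⊎ e ≡ (b , a , t) → Covers e ((x , y , t) , a , b)
      cover (inj₁ refl) = refl , inj₁ refl , inj₂ refl
      cover (inj₂ refl) = refl , inj₂ refl , inj₁ refl
      twice : ∀ {f} → e ≡ (a , b , t) ⊎ e ≡ (b , a , t) → f ≡ (a , b , t) ⊎ f ≡ (b , a , t) → f ∉ P
      twice (inj₁ refl) (inj₁ refl) f∈ = e∉ f∈
      twice (inj₂ refl) (inj₂ refl) f∈ = e∉ f∈
      twice (inj₁ refl) (inj₂ refl) f∈ =
          <-asym (All.lookup (edges-ordered G) e∈) (All.lookup (edges-ordered G) (P⊆ f∈))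
      twice (inj₂ refl) (inj₁ refl) f∈ =
          <-asym (All.lookup (edges-ordered G) e∈) (All.lookup (edges-ordered G) (P⊆ f∈))
      -- Labels recover `a` and `b` from the numbers. An equal earlier item would thus be a pendant
      -- edge with `a ≡ b`, or a copy of an earlier edge on the same pair in the same layer, which
      -- is `e` itself or violates the ordering of end points.
      new : ∀ {i} → Sound ident N label P i → (x , y , t) ≢ proj₁ i
      new (holds _ la lb _ r) refl
        with refl ← Fin.toℕ-injective (trans (sym (proj₂ (ids I a ia))) la)
           | refl ← Fin.toℕ-injective (trans (sym (proj₂ (ids I b ib))) lb) with r
      ... | inj₁ (a≡b , _)      = a≢b a≡b
      ... | inj₂ (_ , inj₁ f∈) = twice e≡ (inj₁ refl) f∈
      ... | inj₂ (_ , inj₂ f∈) = twice e≡ (inj₂ refl) f∈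
      incident : ∀ {s w} → e ≡ (a , b , t) ⊎ e ≡ (b , a , t) → Incident s w (a , b , t) →
          Incident s w e
      incident (inj₁ refl) inc       = inc
      incident (inj₂ refl) (eq , inc) = eq , Sum.swap inc
      status′ : ∀ (s : Time) (w : V) →
          Status s w (D (key s w)) (((x , y , t) , a , b) ∷ out) (e ∷ P)
      status′ s w with status I s w | incident? s w (a , b , t)
      ... | pending eq hi none | no ¬inc =
            pending eq hi (trans (count-reject (incident? s w) ¬inc) none)
      ... | low eq lo ≤P       | no ¬inc =
            low eq lo (≤-trans (≤-reflexive (count-reject (incident? s w) ¬inc))
            (≤-trans ≤P (count-∷ (incident? s w) e P)))
      ... | done ≡0 hi ≤1 p    | no ¬inc =
            done ≡0 hi (≤-trans (≤-reflexive (count-reject (incident? s w) ¬inc)) ≤1) (there p)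
      ... | pending eq hi none | yes inc@(refl , _) = contradiction hi (≤⇒≯ (proj₂ (small w inc)))
      ... | done ≡0 hi ≤1 p    | yes inc@(refl , _) =
            contradiction ≡0 (≢-sym (<⇒≢ (proj₁ (small w inc))))
      ... | low eq lo ≤P       | yes inc =
            low eq lo (subst₂ _≤_ (sym (count-accept (incident? s w) inc))
              (sym (count-accept (incident? s w) (incident e≡ inc))) (s≤s ≤P))

  start : ∀ {D} → (∀ (t : Time) (v : V) → D (key t v) ≡ degree t v E) →
      Partial D (λ _ → 0) 0 (λ _ → 0) [] []
  start {D} D≡ = record { ids = λ _ () ; sound = [] ; distinct = [] ; covered = []
                      ; status = status′ }
    where
    status′ : ∀ (t : Time) (v : V) → Status t v (D (key t v)) [] []
    status′ t v with k <? D (key t v)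
    ... | yes high = pending (D≡ t v) high (count-[] (incident? t v))
    ... | no  ¬high = low (D≡ t v) (≮⇒≥ ¬high) ≤-refl

  module _ {D ident N label out P} (I : Partial D ident N label out P) (P≡ : reverse P ≡ E) where

    finished : Kernel G k N (map proj₁ out)
    finished = record
      { ident = ident ; label = label
      ; below = All.map⁺ (All.map (λ where (holds x<y<N _ _ _ _) → x<y<N) (sound I))
      ; unique = distinct I
      ; sound = All.map⁺ (All.map (λ {i} → sound′ {i}) (sound I))
      ; complete = All.tabulate λ e∈ → Any.map⁺ (complete′ (All.lookup (covered I) (reverse∈ e∈)))
      }
      where
      reverse∈ : ∀ {e} → e ∈ E → e ∈ P
      reverse∈ e∈ = Any.reverse⁻ (subst (_ ∈_) (sym P≡) e∈)
      ∈-E : ∀ {e} → e ∈ P → e ∈ E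
      ∈-E e∈ = subst (_ ∈_) P≡ (Any.reverse⁺ e∈)
      sound′ : ∀ {i} → Sound ident N label P i → let ((x , y , t) , _) = i in
        ∃[ a ] ∃[ b ] ident (toℕ a) ≡ suc x
            × (k < degree t a E ⊎ ident (toℕ b) ≡ suc y × Layer G t a b)
      sound′ (holds {a = a} {b} _ _ _ ia r) =
          a , b , ia , Sum.map proj₂ (λ (ib , j) → ib , Sum.map ∈-E ∈-E j) r
      complete′ : ∀ {u w t} → Any (Covers (u , w , t)) out → Any (λ ((x , y , s) , _) → s ≡ t ×
                 (label x ≡ toℕ u ⊎ label x ≡ toℕ w) × (label y ≡ toℕ u ⊎ label y ≡ toℕ w)) out
      complete′ p with i , i∈ , eq , ca , cb ← find p
          with holds _ la lb _ _ ← All.lookup (sound I) i∈ =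
        lose i∈ (eq , Sum.map (named la) (named la) ca , Sum.map (named lb) (named lb) cb)
        where
        named : ∀ {l} {a b : V} → l ≡ toℕ a → a ≡ b → l ≡ toℕ b
        named la refl = la

    -- The kernel edges are counted through their labels, so that a solution of `G` can serve as the
    -- cover. The assumption `1 ≤ k` accommodates the single pendant edge at a vertex that is done.
    sparse : ∀ {ℓ} → 1 ≤ k → YesInstance (G , k , ℓ) → length out ≤ k ^ 2 * τ G
    sparse 1≤k (S , ok , _) = subst (_≤ k ^ 2 * τ G) (length-map origin out)
      (covered-length≤ S (proj₂ ∘ ok) (All.map⁺ (All.map (λ {i} → cover {i}) (sound I))) small)
      where
      cover : ∀ {i} → Sound ident N label P i → let ((_ , _ , t) , a , b) = i in
        a Subset.∈ lookup S t ⊎ b Subset.∈ lookup S t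
      cover (holds {t = t} _ _ _ _ (inj₁ (_ , high))) =
          inj₁ (high-degree⇒∈ {G} (proj₁ (ok t)) (proj₂ (ok t)) high)
      cover (holds {t = t} {a} {b} _ _ _ _ (inj₂ (_ , j))) = proj₁ (ok t) a b
        (Sum.map (λ e∈ → subst (_ ∈_) P≡ (Any.reverse⁺ e∈))
            (λ e∈ → subst (_ ∈_) P≡ (Any.reverse⁺ e∈)) j)
      small : ∀ (t : Time) (v : V) → degree t v (map origin out) ≤ k
      small t v with status I t v
      ... | pending _ _ none = ≤-trans (≤-reflexive none) z≤n
      ... | low eq lo ≤P = ≤-trans ≤P
            (≤-trans (≤-reflexive (trans (sym (count-reverse (incident? t v) P))
            (trans (cong (degree t v) P≡) (sym eq)))) lo)
      ... | done _ _ ≤1 _ = ≤-trans ≤1 1≤k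

-- Program logic

decide : ∀ b s → Dec (Holds b s)
decide (e ≺ f) s = eval e s <? eval f s
decide (e ≐ f) s = eval e s ≟ eval f s

-- If no loops are nested and every loop makes fewer than 3 * B iterations, then
-- rate P * B bounds the running time of P.
rate : Program → ℕ
rate skip                   = 1
rate (x ≔ e)                = 1 + cost e
rate (a [ e ]≔ f)           = 1 + cost e + cost f
rate (P ⨾ Q)                = rate P + rate Q
rate (if b then P else Q)   = costᵗ b + (rate P + rate Q)
rate (while b loop P)       = 3 * (costᵗ b + rate P)

-- Meaningful for loop-free programs only: ⊥ is a junk value for loops.
wp : Program → (Store → Set) → Store → Set
wp skip                 Q s = Q s
wp (x ≔ e)              Q s = Q (store (reg s [ x ↦ eval e s ]) (arr s))
wp (a [ e ]≔ f)         Q s = Q (store (reg s) (arr s [ a ↦ arr s a [ eval e s ↦ eval f s ] ]))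
wp (P ⨾ P′)             Q s = wp P (wp P′ Q) s
wp (if b then P else P′) Q s = (Holds b s → wp P Q s) × (¬ Holds b s → wp P′ Q s)
wp (while b loop P)     Q s = ⊥

Exec : ℕ → Program → (Store → Set) → Store → Set
Exec B P Q s = ∃[ T ] ∃[ s′ ] (⟨ P , s ⟩⇓[ T ] s′) × T ≤ B × Q s′

wp-sound : ∀ P {Q : Store → Set} {s} → wp P Q s → Exec (rate P) P Q s
wp-sound skip         q = _ , _ , ⇓skip , ≤-refl , q
wp-sound (x ≔ e)      q = _ , _ , ⇓assign , ≤-refl , q
wp-sound (a [ e ]≔ f) q = _ , _ , ⇓write , ≤-refl , q
wp-sound (P ⨾ P′)     q with _ , _ , ⇓P , T≤ , q′ ← wp-sound P q with _ , _ , ⇓P′ , U≤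
    , q″ ← wp-sound P′ q′ =
  _ , _ , ⇓seq ⇓P ⇓P′ , +-mono-≤ T≤ U≤ , q″
wp-sound (if b then P else P′) {s = s} (p , p′) with decide b s
... | yes h with _ , _ , ⇓P , T≤ , q ← wp-sound P (p h)    =
      _ , _ , ⇓then h ⇓P , +-monoʳ-≤ (costᵗ b) (≤-trans T≤ (m≤m+n _ _)) , q
... | no ¬h with _ , _ , ⇓P , T≤ , q ← wp-sound P′ (p′ ¬h) =
      _ , _ , ⇓else ¬h ⇓P , +-monoʳ-≤ (costᵗ b) (≤-trans T≤ (m≤n+m _ _)) , q

weaken : ∀ {B P Q Q′ s} → Exec B P Q s → (∀ {s} → Q s → Q′ s) → Exec B P Q′ s
weaken (T , s′ , ⇓P , T≤ , q) Q⇒Q′ = T , s′ , ⇓P , T≤ , Q⇒Q′ q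

infixr 3 _⨟_

-- Sequencing inside a loop body, where costs are constants; `_then_` is the counterpart at the
-- scale of `B`.
_⨟_ : ∀ {P P′ R Q s} → Exec (rate P) P R s → (∀ {s} → R s → Exec (rate P′) P′ Q s) →
    Exec (rate P + rate P′) (P ⨾ P′) Q s
(_ , _ , ⇓P , T≤ , r) ⨟ next = let _ , _ , ⇓P′ , U≤ , q = next r in
  _ , _ , ⇓seq ⇓P ⇓P′ , +-mono-≤ T≤ U≤ , q

module _ {B : ℕ} (1≤B : 1 ≤ B) where

  straight : ∀ P {Q : Store → Set} {s} → wp P Q s → Exec (rate P * B) P Q s
  straight P q with T , s′ , ⇓P , T≤ , q′ ← wp-sound P q =
      T , s′ , ⇓P , ≤-trans T≤ (m≤m*n _ B ⦃ >-nonZero 1≤B ⦄) , q′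

  infixr 3 _then_

  _then_ : ∀ {P P′ Q R s} → Exec (rate P * B) P R s → (∀ {s} → R s → Exec (rate P′ * B) P′ Q s) →
      Exec (rate (P ⨾ P′) * B) (P ⨾ P′) Q s
  _then_ {P} {P′} (_ , _ , ⇓P , T≤ , r) next with _ , _ , ⇓P′ , U≤ , q ← next r =
    _ , _ , ⇓seq ⇓P ⇓P′ , ≤-trans (+-mono-≤ T≤ U≤)
        (≤-reflexive (sym (*-distribʳ-+ B (rate P) (rate P′)))) , q

  branch : ∀ {b P P′ Q s} → (Holds b s → Exec (rate P * B) P Q s) →
      (¬ Holds b s → Exec (rate P′ * B) P′ Q s) →
    Exec (rate (if b then P else P′) * B) (if b then P else P′) Q s
  branch {b} {P} {P′} {s = s} p p′ = go (decide b s)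
    where
    bound : ∀ {T} r → T ≤ r * B → r ≤ rate P + rate P′ →
        costᵗ b + T ≤ (costᵗ b + (rate P + rate P′)) * B
    bound r T≤ r≤ = ≤-trans (+-mono-≤ (m≤m*n (costᵗ b) B ⦃ >-nonZero 1≤B ⦄)
        (≤-trans T≤ (*-monoˡ-≤ B r≤)))
      (≤-reflexive (sym (*-distribʳ-+ B (costᵗ b) _)))
    go : Dec (Holds b s) → _
    go (yes h) = let _ , _ , ⇓P , T≤ , q = p h   in
      _ , _ , ⇓then h ⇓P , bound (rate P) T≤ (m≤m+n _ _) , q
    go (no ¬h) = let _ , _ , ⇓P , T≤ , q = p′ ¬h in
      _ , _ , ⇓else ¬h ⇓P , bound (rate P′) T≤ (m≤n+m _ _) , q

  -- A loop that consumes the list E; its invariant speaks about the reversed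
  -- list of the entries consumed so far.
  foreach : ∀ {b P s} (Inv : List A → Store → Set) (E : List A) → length E < 3 * B →
    (∀ {D x R s} → D ʳ++ (x ∷ R) ≡ E → Inv D s → Holds b s × Exec (rate P) P (Inv (x ∷ D)) s) →
    (∀ {D s} → reverse D ≡ E → Inv D s → ¬ Holds b s) → Inv [] s →
    Exec (rate (while b loop P) * B) (while b loop P) (λ s → ∃[ D ] reverse D ≡ E × Inv D s) s
  foreach {b = b} {P} Inv E short step stop start =
    let T , s′ , ⇓P , T≤ , q = go [] E refl start in T , s′ , ⇓P
            , ≤-trans T≤ (≤-trans (*-monoˡ-≤ c short)
            (≤-reflexive (trans (*-assoc 3 B c)
            (trans (cong (3 *_) (*-comm B c)) (sym (*-assoc 3 c B)))))) , q
    where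
    c = costᵗ b + rate P
    -- The extra unit in `suc (length R)` pays for the final failing test; this is why `short` is a
    -- strict inequality.
    go : ∀ D R {s} → D ʳ++ R ≡ E → Inv D s →
      Exec (suc (length R) * c) (while b loop P) (λ s → ∃[ D ] reverse D ≡ E × Inv D s) s
    go D [] eq inv = _ , _ , ⇓stop (stop eq inv) , ≤-trans (m≤m+n _ _) (m≤m+n _ _) , D , eq , inv
    go D (x ∷ R) eq inv with h , _ , _ , ⇓P , T≤ , inv′ ← step eq inv
      with _ , _ , ⇓loop′ , U≤ , q ← go (x ∷ D) R eq inv′ =
      _ , _ , ⇓loop h ⇓P ⇓loop′ , +-mono-≤ (+-monoʳ-≤ (costᵗ b) T≤) U≤ , q

  fromZero : ∀ {b P s} (Inv : ℕ → Store → Set) (M : ℕ) → M < 3 * B →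
    (∀ {i s} → i < M → Inv i s → Holds b s × Exec (rate P) P (Inv (suc i)) s) →
    (∀ {s} → Inv M s → ¬ Holds b s) → Inv 0 s →
    Exec (rate (while b loop P) * B) (while b loop P) (Inv M) s
  fromZero {b} {P} Inv M short step stop start =
    let T , s′ , ⇓P , T≤ , D , eq , inv =
            foreach {b = b} {P} (Inv ∘ length) (replicate M tt)
            (subst (_< 3 * B) (sym (length-replicate M)) short)
          (λ {D} {x} {R} eq → step (subst (length D <_) (full D (x ∷ R) eq)
              (m<m+n (length D) (s≤s z≤n))))
              (λ {D} eq inv → stop (subst (λ i → Inv i _) (all D eq) inv)) start
    in T , s′ , ⇓P , T≤ , subst (λ i → Inv i s′) (all D eq) inv
    where
    full : ∀ D R → D ʳ++ R ≡ replicate M tt → length D + length R ≡ M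
    full D R eq = trans (sym (length-ʳ++ D)) (trans (cong length eq) (length-replicate M))
    all : ∀ D → reverse D ≡ replicate M tt → length D ≡ M
    all D eq = trans (sym (length-reverse D)) (trans (cong length eq) (length-replicate M))

-- Arrays

at-∷ʳ-< : ∀ xs {x j} → j < length xs → at (xs ∷ʳ x) j ≡ at xs j
at-∷ʳ-< (_ ∷ xs) {j = zero}  _         = refl
at-∷ʳ-< (_ ∷ xs) {j = suc j} (s≤s j<) = at-∷ʳ-< xs j<

at-∷ʳ-≡ : ∀ xs {x} → at (xs ∷ʳ x) (length xs) ≡ x
at-∷ʳ-≡ []       = refl
at-∷ʳ-≡ (_ ∷ xs) = at-∷ʳ-≡ xs

-- In the splittings of `foreach`, `D` is the consumed part in reverse, so the entry to be read has
-- index `length D`.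
at-ʳ++ : ∀ (f : A → ℕ) D {x R} → at (map f (D ʳ++ (x ∷ R))) (length D) ≡ f x
at-ʳ++ f D {x} {R} = trans (cong (λ i → at (map f (D ʳ++ (x ∷ R))) i) (sym (+-identityʳ _)))
    (go D (x ∷ R) 0)
  where
  go : ∀ D R j → at (map f (D ʳ++ R)) (length D + j) ≡ at (map f R) j
  go []      R j = refl
  go (y ∷ D) R j = trans (cong (at (map f (D ʳ++ (y ∷ R)))) (sym (+-suc (length D) j)))
      (go D (y ∷ R) (suc j))

unique-ʳ++ : ∀ (D : List A) {x R} → Unique (D ʳ++ (x ∷ R)) → x ∉ D
unique-ʳ++ D uniq = go D uniq (here refl)
  where
  tail : ∀ (D : List A) {R} → Unique (D ʳ++ R) → Unique R
  tail []      uniq = uniq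
  tail (y ∷ D) uniq = AllPairs.tail (tail D uniq)
  go : ∀ (D : List A) {x R} → Unique (D ʳ++ R) → x ∈ R → x ∉ D
  go (y ∷ D) uniq x∈R (here refl) = All.lookup (AllPairs.head (tail D uniq)) x∈R refl
  go (y ∷ D) uniq x∈R (there x∈D) = go D uniq (there x∈R) x∈D

Agree : ℕ → (ℕ → ℕ) → (ℕ → ℕ) → Set
Agree M a b = ∀ {j} → j < M → a j ≡ b j

agree-extend : ∀ {M a b i x} → Agree M a b → i ≡ M → x ≡ b M → Agree (suc M) (a [ i ↦ x ]) b
agree-extend {M} {a} old refl refl {j} (s≤s j≤M) with M ≟ j
... | yes refl = refl
... | no  M≢j  = old (≤∧≢⇒< j≤M (≢-sym M≢j))

Stored : (ℕ → ℕ) → List ℕ → Set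
Stored a xs = Agree (length xs) a (at (reverse xs))

stored-push : ∀ {a} xs {i x v} → Stored a xs → i ≡ length xs → v ≡ x → Stored (a [ i ↦ v ]) (x ∷ xs)
stored-push xs {x = x} old refl refl =
    agree-extend (λ j< → trans (old j<) (push-old j<)) refl (sym push-new)
  where
  push-old : ∀ {j} → j < length xs → at (reverse xs) j ≡ at (reverse (x ∷ xs)) j
  push-old {j} j< = trans (sym (at-∷ʳ-< (reverse xs) (subst (j <_) (sym (length-reverse xs)) j<)))
      (cong (λ ys → at ys j) (sym (unfold-reverse x xs)))
  push-new : at (reverse (x ∷ xs)) (length xs) ≡ x
  push-new = trans (cong₂ at (unfold-reverse x xs) (sym (length-reverse xs))) (at-∷ʳ-≡ (reverse xs))

record Written (e : ℕ) (a₀ a₁ a₂ : ℕ → ℕ) (L : List (Arc T)) : Set where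
  constructor written
  field
    size    : e ≡ length L
    stored₀ : Stored a₀ (map proj₁ L)
    stored₁ : Stored a₁ (map (proj₁ ∘ proj₂) L)
    stored₂ : Stored a₂ (map (toℕ ∘ proj₂ ∘ proj₂) L)

written-push : ∀ {e a₀ a₁ a₂ x y v₀ v₁ v₂} {t : Fin T} {L} → Written e a₀ a₁ a₂ L → v₀ ≡ x →
    v₁ ≡ y → v₂ ≡ toℕ t →
  Written (suc e) (a₀ [ e ↦ v₀ ]) (a₁ [ e ↦ v₁ ]) (a₂ [ e ↦ v₂ ]) ((x , y , t) ∷ L)
written-push {L = L} (written size s₀ s₁ s₂) v₀≡ v₁≡ v₂≡ = written (cong suc size)
  (stored-push (map proj₁ L) s₀ (trans size (sym (length-map proj₁ L))) v₀≡)
  (stored-push (map (proj₁ ∘ proj₂) L) s₁ (trans size (sym (length-map (proj₁ ∘ proj₂) L))) v₁≡)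
  (stored-push (map (toℕ ∘ proj₂ ∘ proj₂) L) s₂
      (trans size (sym (length-map (toℕ ∘ proj₂ ∘ proj₂) L))) v₂≡)

lower upper time : Edge N T → ℕ
lower (u , _ , _) = toℕ u
upper (_ , w , _) = toℕ w
time (_ , _ , t) = toℕ t

-- The program

nᵣ τᵣ kᵣ ℓᵣ mᵣ iᵣ capᵣ squareᵣ limitᵣ sizeᵣ nextᵣ tᵣ xᵣ accᵣ : Var
nᵣ = 0
τᵣ = 1
kᵣ = 2
ℓᵣ = 3
mᵣ = 4
iᵣ = 5
capᵣ = 6
squareᵣ = 7
limitᵣ = 8
sizeᵣ = 9
nextᵣ = 10
tᵣ = 11
xᵣ = 12
accᵣ = 13

lowers uppers times rows table idents lowers′ uppers′ times′ : Arr
lowers = 0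
uppers = 1
times = 2
rows = 3
table = 4
idents = 5
lowers′ = 6
uppers′ = 7
times′ = 8

advance reset computeCap squareBody computeSquare rowsBody computeRows : Program
countBody copyAndCount : Program
advance = iᵣ ≔ lit 1 ⊕ var iᵣ
reset = iᵣ ≔ lit 0

-- min (k , 3 m); the cap keeps the running time independent of k.
computeCap = capᵣ ≔ var kᵣ ⊖ (var kᵣ ⊖ (var mᵣ ⊕ (var mᵣ ⊕ var mᵣ)))

squareBody = squareᵣ ≔ var capᵣ ⊕ var squareᵣ ⨾ advance

computeSquare = while var iᵣ ≺ var capᵣ loop squareBody

-- For want of multiplication, the row offsets of the degree table and the limit accumulate by
-- repeated addition, one summand per layer.
rowsBody = rows [ var iᵣ ]≔ var accᵣ
         ⨾ accᵣ ≔ var nᵣ ⊕ var accᵣ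
         ⨾ limitᵣ ≔ var squareᵣ ⊕ var limitᵣ
         ⨾ advance

computeRows = while var iᵣ ≺ var τᵣ loop rowsBody

bump : Exp → Program
bump x = table [ rows ‼ (times ‼ var iᵣ) ⊕ x ]≔ lit 1 ⊕ table ‼ (rows ‼ (times ‼ var iᵣ) ⊕ x)

-- The output overwrites the arrays of the input and may run ahead of the reading position, since
-- one edge can emit three; hence the copies.
countBody = lowers′ [ var iᵣ ]≔ lowers ‼ var iᵣ
          ⨾ uppers′ [ var iᵣ ]≔ uppers ‼ var iᵣ
          ⨾ times′  [ var iᵣ ]≔ times  ‼ var iᵣ
          ⨾ bump (lowers ‼ var iᵣ)
          ⨾ bump (uppers ‼ var iᵣ)
          ⨾ advance

copyAndCount = while var iᵣ ≺ var mᵣ loop countBody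

-- a ⊖ (a ⊖ b) and b ⊕ (a ⊖ b) are the minimum and the maximum.  The array
-- idents holds 1 + x for the new vertex x, and 0 for an unnumbered vertex.
emit : Exp → Exp → Program
emit a b = lowers [ var sizeᵣ ]≔ (a ⊖ (a ⊖ b)) ⊖ lit 1
         ⨾ uppers [ var sizeᵣ ]≔ (b ⊕ (a ⊖ b)) ⊖ lit 1
         ⨾ times [ var sizeᵣ ]≔ var tᵣ
         ⨾ sizeᵣ ≔ lit 1 ⊕ var sizeᵣ

assign attach pendant keep settle process kernelize : Program
overflowBody overflow guard main program : Program
assign = if idents ‼ var xᵣ ≐ lit 0
  then (nextᵣ ≔ lit 1 ⊕ var nextᵣ ⨾ idents [ var xᵣ ]≔ var nextᵣ)
  else skip

slot : Exp → Exp
slot x = rows ‼ var tᵣ ⊕ x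

-- After the increment `nextᵣ` is already the code, one more than the number, of the fresh vertex,
-- as `emit` expects.
attach = nextᵣ ≔ lit 1 ⊕ var nextᵣ
       ⨾ emit (idents ‼ var xᵣ) (var nextᵣ)
       ⨾ table [ slot (var xᵣ) ]≔ lit 0

pendant = if var kᵣ ≺ table ‼ slot (var xᵣ)
  then (assign ⨾ attach)
  else skip

keep = xᵣ ≔ lowers′ ‼ var iᵣ
     ⨾ assign
     ⨾ xᵣ ≔ uppers′ ‼ var iᵣ
     ⨾ assign
     ⨾ emit (idents ‼ (lowers′ ‼ var iᵣ)) (idents ‼ (uppers′ ‼ var iᵣ))

settle = if lit 0 ≺ table ‼ slot (lowers′ ‼ var iᵣ)
  then (if lit 0 ≺ table ‼ slot (uppers′ ‼ var iᵣ) then keep else skip)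
  else skip

process = tᵣ ≔ times′ ‼ var iᵣ
        ⨾ xᵣ ≔ lowers′ ‼ var iᵣ ⨾ pendant
        ⨾ xᵣ ≔ uppers′ ‼ var iᵣ ⨾ pendant
        ⨾ settle
        ⨾ advance

kernelize = while var iᵣ ≺ var mᵣ loop process

overflowBody = lowers [ var sizeᵣ ]≔ var nextᵣ
             ⨾ uppers [ var sizeᵣ ]≔ lit 1 ⊕ var nextᵣ
             ⨾ times [ var sizeᵣ ]≔ lit 0
             ⨾ nextᵣ ≔ lit 2 ⊕ var nextᵣ
             ⨾ sizeᵣ ≔ lit 1 ⊕ var sizeᵣ

overflow = sizeᵣ ≔ lit 0 ⨾ nextᵣ ≔ lit 0 ⨾ while var sizeᵣ ≺ lit 1 ⊕ var kᵣ loop overflowBody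

guard = if var limitᵣ ≺ var sizeᵣ then overflow else skip

main = computeCap
     ⨾ computeSquare ⨾ reset
     ⨾ computeRows ⨾ reset
     ⨾ copyAndCount ⨾ reset
     ⨾ kernelize
     ⨾ guard
     ⨾ nᵣ ≔ var nextᵣ
     ⨾ mᵣ ≔ var sizeᵣ

-- The loop over the layers takes τ steps, too many for the budget if there are no vertices. An edge
-- guarantees |V|²τ ≥ τ, so the edgeless case is answered at once.
program = if lit 0 ≺ var mᵣ then main else (nᵣ ≔ lit 0)

-- Correctness of the loop body on one edge

module _ (G : TemporalGraph) (k ℓ : ℕ) where

  private
    E = edges G
    V = Fin (n G)
    Time = Fin (τ G)
    m = ∣ℰ∣ G

  Inputs : Store → Set
  Inputs s = reg s nᵣ ≡ n G × reg s τᵣ ≡ τ G × reg s kᵣ ≡ k × reg s ℓᵣ ≡ ℓ × reg s mᵣ ≡ m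

  Sources : (ℕ → ℕ) → (ℕ → ℕ) → (ℕ → ℕ) → Set
  Sources a₀ a₁ a₂ = Agree m a₀ (at (map lower E)) × Agree m a₁ (at (map upper E))
      × Agree m a₂ (at (map time E))

  module _ (limit : ℕ) where

    Env : Store → Set
    Env s = Inputs s × Agree (τ G) (arr s rows) (_* n G) × reg s limitᵣ ≡ limit

    -- slack counts the vertices numbered for the item that is emitted next.
    record Output (D ident : ℕ → ℕ) (N e : ℕ) (a₀ a₁ a₂ : ℕ → ℕ) (P : List (Edge (n G) (τ G)))
        (few slack : ℕ) : Set where
      constructor output
      field
        {label} : ℕ → ℕ
        {out}   : List (Item (n G) (τ G))
        partial : Partial G k D ident N label out P
        printed : Written e a₀ a₁ a₂ (map proj₁ out)
        few≤    : length out ≤ few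
        next≤   : N ≤ slack + (length out + length out)

    Out : List (Edge (n G) (τ G)) → ℕ → ℕ → Store → Set
    Out P few slack s = Output (arr s table) (arr s idents) (reg s nextᵣ) (reg s sizeᵣ)
        (arr s lowers) (arr s uppers) (arr s times) P few slack

    module _ (P : List (Edge (n G) (τ G))) (t : Time) where

      Ctx : Store → Set
      Ctx s = Env s × Sources (arr s lowers′) (arr s uppers′) (arr s times′) × reg s iᵣ ≡ length P
          × reg s tᵣ ≡ toℕ t

      address : ∀ s {x} {v : V} → Ctx s → x ≡ toℕ v → arr s rows (reg s tᵣ) + x ≡ key t v
      address s {x} {v} ((_ , rows≡ , _) , _ , _ , t≡) refl =
        trans (cong (_+ x) (trans (cong (arr s rows) t≡) (rows≡ (Fin.toℕ<n t)))) (key≡ t v)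

      Keeps : Store → Store → Set
      Keeps s s′ = arr s′ table ≡ arr s table
          × (∀ (w : V) {x} → arr s idents (toℕ w) ≡ suc x → arr s′ idents (toℕ w) ≡ suc x)

      -- Both branches enter one continuation with the same facts; a vertex that already has a
      -- number just leaves the granted unit of slack unspent.
      assign-wp : ∀ {Q : Store → Set} {s few slack} {v : V} → reg s xᵣ ≡ toℕ v → Ctx s →
          Out P few slack s →
        (∀ {s′} → reg s′ xᵣ ≡ toℕ v → Ctx s′ → Out P few (suc slack) s′ → Keeps s s′ →
            ∃[ x ] arr s′ idents (toℕ v) ≡ suc x → Q s′) →
        wp assign Q s
      assign-wp {Q} {s} {v = v} x≡ ctx (output I pr few≤ next≤) q = new , old
        where
        new : arr s idents (reg s xᵣ) ≡ 0 → _
        new ≡0 = q x≡ ctx (output (assign-step G k I v x≡ ≡0) pr few≤ (s≤s next≤))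
          (refl , λ w iw → trans (↦-other (arr s idents) λ x≡w →
              0≢1+n (trans (sym ≡0) (trans (cong (arr s idents) x≡w) iw))) iw)
          (_ , subst (λ i → (arr s idents [ reg s xᵣ ↦ suc (reg s nextᵣ) ]) i
              ≡ suc (reg s nextᵣ)) x≡ (↦-same (arr s idents) (reg s xᵣ)))
        old : ¬ arr s idents (reg s xᵣ) ≡ 0 → Q s
        old ≢0 = q x≡ ctx (output I pr few≤ (m≤n⇒m≤1+n next≤)) (refl , λ _ → id)
            (positive (subst (λ x → arr s idents x ≢ 0) x≡ ≢0))
          where
          positive : ∀ {y} → y ≢ 0 → ∃[ x ] y ≡ suc x
          positive {zero}  y≢0 = contradiction refl y≢0
          positive {suc x} _   = x , refl

      -- The last clause carries the bound at the lower end point past the treatment of the upper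
      -- one.
      Bound : V → ℕ → Store → Store → Set
      Bound v few s s′ = Ctx s′ × Out P few 0 s′ × arr s′ table (key t v) ≤ k
          × (∀ q → arr s table q ≤ k → arr s′ table q ≤ k)

      attach-wp : ∀ {s s′ few} {v : V} → reg s′ xᵣ ≡ toℕ v → Ctx s′ → Out P few 1 s′ → Keeps s s′ →
          k < arr s table (key t v) →
        ∃[ x ] arr s′ idents (toℕ v) ≡ suc x → wp attach (Bound v (suc few) s) s′
      attach-wp {s} {s′} {few} {v} x≡ ctx (output I pr few≤ next≤) (table≡ , _) k< (x , iv) =
          ctx
        , output (pendant-step G k I p≡ k<′ iv)
            (written-push pr lower≡ upper≡ (proj₂ (proj₂ (proj₂ ctx)))) (s≤s few≤)
            -- At most one number for `v` and one for the fresh vertex: two per emitted edge.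
            (≤-trans (s≤s next≤) (≤-reflexive (cong suc (sym (+-suc _ _)))))
        , subst (λ q → (D [ p ↦ 0 ]) q ≤ k) p≡ (≤-trans (≤-reflexive (↦-same D p)) z≤n)
        , λ q q≤ → reset≤ q (subst (λ a → a q ≤ k) (sym table≡) q≤)
        where
        D = arr s′ table
        p = arr s′ rows (reg s′ tᵣ) + reg s′ xᵣ
        p≡ : p ≡ key t v
        p≡ = address s′ ctx x≡
        k<′ : k < D p
        k<′ = subst (k <_) (trans (sym (cong (λ a → a (key t v)) table≡)) (cong D (sym p≡))) k<
        x<N : x < reg s′ nextᵣ
        x<N = proj₁ (Partial.ids I v iv)
        i = arr s′ idents (reg s′ xᵣ)
        i≡ : i ≡ suc x
        i≡ = trans (cong (arr s′ idents) x≡) iv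
        lower≡ : i ∸ (i ∸ suc (reg s′ nextᵣ)) ∸ 1 ≡ x
        lower≡ rewrite i≡ | m≤n⇒m∸n≡0 (<⇒≤ x<N) = refl
        upper≡ : suc (reg s′ nextᵣ) + (i ∸ suc (reg s′ nextᵣ)) ∸ 1 ≡ reg s′ nextᵣ
        upper≡ rewrite i≡ | m≤n⇒m∸n≡0 (<⇒≤ x<N) = +-identityʳ (reg s′ nextᵣ)
        reset≤ : ∀ q → D q ≤ k → (D [ p ↦ 0 ]) q ≤ k
        reset≤ q q≤ with p ≟ q
        ... | yes _ = z≤n
        ... | no  _ = q≤

      pendant-wp : ∀ {s few} {v : V} → reg s xᵣ ≡ toℕ v → Ctx s → Out P few 0 s →
          wp pendant (Bound v (suc few) s) s
      pendant-wp {s} {few} {v} x≡ ctx@((((_ , _ , k≡ , _ , _) , _) , _)) out = high , unchanged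
        where
        high : reg s kᵣ < arr s table (arr s rows (reg s tᵣ) + reg s xᵣ) →
            wp assign (wp attach (Bound v (suc few) s)) s
        high k< = assign-wp {Q = wp attach (Bound v (suc few) s)}
            {s = s} x≡ ctx out λ {s′} x≡′ ctx′ out′ keeps → attach-wp {s} {s′} x≡′ ctx′ out′ keeps
          (subst₂ _<_ k≡ (cong (arr s table) (address s ctx x≡)) k<)
        unchanged : ¬ reg s kᵣ < arr s table (arr s rows (reg s tᵣ) + reg s xᵣ) →
            Bound v (suc few) s s
        unchanged ¬high = ctx , output (Output.partial out) (Output.printed out)
            (m≤n⇒m≤1+n (Output.few≤ out)) (Output.next≤ out)
                  , subst₂ _≤_ (cong (arr s table) (address s ctx x≡)) k≡ (≮⇒≥ ¬high) , λ _ → id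

    Progress : List (Edge (n G) (τ G)) → Store → Set
    Progress P s = Env s × Sources (arr s lowers′) (arr s uppers′) (arr s times′)
        × reg s iᵣ ≡ length P × Out P (length P * 3) 0 s

    module _ {P R : List (Edge (n G) (τ G))} {u w : V} {t : Time}
        (P≡ : P ʳ++ ((u , w , t) ∷ R) ≡ E) where

      private
        e = u , w , t

      e∈E : e ∈ E
      e∈E = subst (e ∈_) P≡ (Any.reverseAcc⁺ (e ∷ R) P (inj₁ (here refl)))

      P⊆E : ∀ {f} → f ∈ P → f ∈ E
      P⊆E f∈ = subst (_ ∈_) P≡ (Any.reverseAcc⁺ (e ∷ R) P (inj₂ f∈))

      e∉P : e ∉ P
      e∉P = unique-ʳ++ P (subst Unique (sym P≡) (edges-unique G))

      P<m : length P < m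
      P<m = subst (length P <_) (trans (sym (length-ʳ++ P)) (cong length P≡))
          (m<m+n (length P) (s≤s z≤n))

      u≢w : u ≢ w
      u≢w refl = <-irrefl refl (All.lookup (edges-ordered G) e∈E)

      current : ∀ (f : Edge (n G) (τ G) → ℕ) {a i} → Agree m a (at (map f E)) → i ≡ length P →
          a i ≡ f e
      current f ag refl = trans (ag P<m)
          (trans (cong (λ es → at (map f es) (length P)) (sym P≡)) (at-ʳ++ f P))

      Done : ℕ → Store → Set
      Done few s = Ctx P t s × Out (e ∷ P) few 0 s

      keep-wp : ∀ {s few} → Ctx P t s → Out P few 0 s →
        (∀ {v} → v ≡ u ⊎ v ≡ w → 0 < arr s table (key t v) × arr s table (key t v) ≤ k) →
            wp keep (Done (suc few)) s
      keep-wp {s} {few} ctx@(_ , (lo , up , _) , i≡ , _) out small =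
        assign-wp P t {Q = wp afterFirst (Done (suc few))} {s = s₁} {v = u}
            (current lower lo i≡) ctx out λ {s₂} _ ctx₂ out₂ keeps₂ (x , iu) →
        assign-wp P t {Q = wp afterSecond (Done (suc few))}
            {s = store (reg s₂ [ xᵣ ↦ arr s₂ uppers′ (reg s₂ iᵣ) ]) (arr s₂)} {v = w}
          (current upper (proj₁ (proj₂ (proj₁ (proj₂ ctx₂))))
              (proj₁ (proj₂ (proj₂ ctx₂)))) ctx₂ out₂ λ {s₃} _ ctx₃ out₃ keeps₃ (y , iw) →
        emit-wp {s₃} ctx₃ out₃ (λ v∈ → subst (λ a → 0 < a (key t _) × a (key t _) ≤ k)
            (sym (trans (proj₁ keeps₃) (proj₁ keeps₂))) (small v∈))
          (proj₂ keeps₃ u iu) iw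
        where
        s₁ = store (reg s [ xᵣ ↦ arr s lowers′ (reg s iᵣ) ]) (arr s)
        afterSecond afterFirst : Program
        afterSecond = emit (idents ‼ (lowers′ ‼ var iᵣ)) (idents ‼ (uppers′ ‼ var iᵣ))
        afterFirst = xᵣ ≔ uppers′ ‼ var iᵣ ⨾ assign ⨾ afterSecond
        emit-wp : ∀ {s x y} → Ctx P t s → Out P few 2 s →
          (∀ {v} → v ≡ u ⊎ v ≡ w → 0 < arr s table (key t v) × arr s table (key t v) ≤ k) →
          arr s idents (toℕ u) ≡ suc x → arr s idents (toℕ w) ≡ suc y →
              wp afterSecond (Done (suc few)) s
        emit-wp {s} {x} {y} ctx@(_ , (lo , up , _) , i≡ , t≡)
            (output {label} {out} I pr few≤ next≤) small iu iw = ctx , emitted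
          where
          a = arr s idents (arr s lowers′ (reg s iᵣ))
          b = arr s idents (arr s uppers′ (reg s iᵣ))
          a≡ : a ≡ suc x
          a≡ = trans (cong (arr s idents) (current lower lo i≡)) iu
          b≡ : b ≡ suc y
          b≡ = trans (cong (arr s idents) (current upper up i≡)) iw
          next≤′ : reg s nextᵣ ≤ suc (length out) + suc (length out)
          next≤′ = ≤-trans next≤ (≤-reflexive (cong suc (sym (+-suc _ _))))
          emitted : Output (arr s table) (arr s idents) (reg s nextᵣ) (suc (reg s sizeᵣ))
                      (arr s lowers [ reg s sizeᵣ ↦ a ∸ (a ∸ b) ∸ 1 ])
                          (arr s uppers [ reg s sizeᵣ ↦ b + (a ∸ b) ∸ 1 ])
                      (arr s times [ reg s sizeᵣ ↦ reg s tᵣ ]) (e ∷ P) (suc few) 0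
          -- Either end may have been numbered first, so both orders occur; equal numbers would have
          -- equal labels and identify `u` with `w`.
          emitted with <-cmp x y
          ... | tri< x<y _ _ = output
                (keep-step G k I (inj₁ refl) e∈E P⊆E e∉P
                    (λ v (_ , v∈) → small (Sum.map sym sym v∈)) iu iw x<y)
                (written-push pr (trans (cong₂ (λ a b → a ∸ (a ∸ b) ∸ 1) a≡ b≡)
                    (cong (λ d → suc x ∸ d ∸ 1) (m≤n⇒m∸n≡0 (<⇒≤ x<y))))
                                 (trans (cong₂ (λ a b → b + (a ∸ b) ∸ 1) a≡ b≡)
                                     (trans (cong (λ d → y + d) (m≤n⇒m∸n≡0 (<⇒≤ x<y)))
                                     (+-identityʳ y))) t≡)
                (s≤s few≤) next≤′
          ... | tri> _ _ y<x = output
                (keep-step G k I (inj₂ refl) e∈E P⊆E e∉P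
                    (λ v (_ , v∈) → small (Sum.swap (Sum.map sym sym v∈))) iw iu y<x)
                (written-push pr (trans (cong₂ (λ a b → a ∸ (a ∸ b) ∸ 1) a≡ b≡)
                    (cong (_∸ 1) (m∸[m∸n]≡n (s≤s (<⇒≤ y<x)))))
                                 (trans (cong₂ (λ a b → b + (a ∸ b) ∸ 1) a≡ b≡)
                                     (m+[n∸m]≡n (<⇒≤ y<x))) t≡)
                (s≤s few≤) next≤′
          ... | tri≈ _ refl _ = contradiction
                (Fin.toℕ-injective (trans (sym (proj₂ (Partial.ids I u iu)))
                (proj₂ (Partial.ids I w iw)))) u≢w

      settle-wp : ∀ {s few} → Ctx P t s → Out P few 0 s → arr s table (key t u) ≤ k →
          arr s table (key t w) ≤ k →
        wp settle (Done (suc few)) s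
      settle-wp {s} {few} ctx@(_ , (lo , up , _) , i≡ , _) out u≤ w≤ =
        (λ 0<u → (λ 0<w → keep-wp {s} {few} ctx out λ where
                     (inj₁ refl) → subst (λ q → 0 < arr s table q) slotᵘ 0<u , u≤
                     (inj₂ refl) → subst (λ q → 0 < arr s table q) slotʷ 0<w , w≤)
               , (λ ¬0<w → skipped (inj₂ refl) (subst (λ q → ¬ 0 < arr s table q) slotʷ ¬0<w)))
        , (λ ¬0<u → skipped (inj₁ refl) (subst (λ q → ¬ 0 < arr s table q) slotᵘ ¬0<u))
        where
        slotᵘ = address P t s ctx (current lower lo i≡)
        slotʷ = address P t s ctx (current upper up i≡)
        skipped : ∀ {v} → u ≡ v ⊎ w ≡ v → ¬ 0 < arr s table (key t v) → Done (suc few) s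
        skipped inc ≡0 = ctx , output (skip-step G k (Output.partial out)
            (reset⇒covered G k (Output.partial out) e∈E (refl , inc) (n≤0⇒n≡0 (≮⇒≥ ≡0))))
          (Output.printed out) (m≤n⇒m≤1+n (Output.few≤ out)) (Output.next≤ out)

      advanced : ∀ {s} → Done (length (e ∷ P) * 3) s →
          Exec (rate advance) advance (Progress (e ∷ P)) s
      advanced {s} ((env , sources , i≡ , _) , out) =
          wp-sound advance {Q = Progress (e ∷ P)} {s = s} (env , sources , cong suc i≡ , out)

      Settled : ℕ → V → Store → Set
      Settled few v s = Ctx P t s × Out P few 0 s × arr s table (key t v) ≤ k

      first : ∀ {s} → Progress P s → Exec (rate (tᵣ ≔ times′ ‼ var iᵣ)) (tᵣ ≔ times′ ‼ var iᵣ)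
          (λ s → Ctx P t s × Out P (length P * 3) 0 s) s
      first {s} (env , sources@(_ , _ , ti) , i≡ , out) =
          _ , _ , ⇓assign , ≤-refl , (env , sources , i≡ , current time ti i≡) , out

      select-lower : ∀ {s few} → Ctx P t s × Out P few 0 s →
        Exec (rate (xᵣ ≔ lowers′ ‼ var iᵣ)) (xᵣ ≔ lowers′ ‼ var iᵣ)
            (λ s → reg s xᵣ ≡ toℕ u × Ctx P t s × Out P few 0 s) s
      select-lower {s} ((env , sources@(lo , _ , _) , i≡ , t≡) , out) =
          _ , _ , ⇓assign , ≤-refl , current lower lo i≡ , (env , sources , i≡ , t≡) , out

      pendant-lower : ∀ {s few} → reg s xᵣ ≡ toℕ u × Ctx P t s × Out P few 0 s →
          Exec (rate pendant) pendant (Settled (suc few) u) s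
      pendant-lower {s} {few} (x≡ , ctx , out) =
          weaken (wp-sound pendant {Q = Bound P t u (suc few) s} {s = s}
          (pendant-wp P t {s = s} {few} {v = u} x≡ ctx out))
        (λ {s₁} (ctx , out , u≤ , _) → ctx , out , u≤)

      select-upper : ∀ {s few} → Settled few u s →
        Exec (rate (xᵣ ≔ uppers′ ‼ var iᵣ)) (xᵣ ≔ uppers′ ‼ var iᵣ)
            (λ s → reg s xᵣ ≡ toℕ w × Settled few u s) s
      select-upper {s} ((env , sources@(_ , up , _) , i≡ , t≡) , out , u≤) =
          _ , _ , ⇓assign , ≤-refl , current upper up i≡ , (env , sources , i≡ , t≡) , out , u≤

      pendant-upper : ∀ {s few} → reg s xᵣ ≡ toℕ w × Settled few u s →
          Exec (rate pendant) pendant (λ s → Settled (suc few) u s × arr s table (key t w) ≤ k) s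
      pendant-upper {s} {few} (x≡ , ctx , out , u≤) =
          weaken (wp-sound pendant {Q = Bound P t w (suc few) s} {s = s}
          (pendant-wp P t {s = s} {few} {v = w} x≡ ctx out))
        (λ {s₁} (ctx , out , w≤ , keeps) → (ctx , out , keeps (key t u) u≤) , w≤)

      settle-exec : ∀ {s few} → Settled few u s × arr s table (key t w) ≤ k →
          Exec (rate settle) settle (Done (suc few)) s
      settle-exec {s} {few} ((ctx , out , u≤) , w≤) =
          wp-sound settle {Q = Done (suc few)} {s = s} (settle-wp {s} {few} ctx out u≤ w≤)

      -- Each pendant test and the settlement raise the allowance `few` by one; the total of three
      -- is the 3 in `length (e ∷ P) * 3`.
      process-exec : ∀ {s} → Progress P s → Exec (rate process) process (Progress (e ∷ P)) s
      process-exec {s} progress = first {s} progress ⨟ λ {s} q →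
          select-lower {s} {length P * 3} q ⨟ λ {s} q → pendant-lower {s} {length P * 3} q
        ⨟ λ {s} q → select-upper {s} {1 + length P * 3} q ⨟ λ {s} q →
            pendant-upper {s} {1 + length P * 3} q
        ⨟ λ {s} q → settle-exec {s} {2 + length P * 3} q ⨟ λ {s} q → advanced {s} q

-- Reading the output graph off the store

module _ {L : List (Arc T)} (1≤T : 1 ≤ T) (below : All (Below N) L) (unique : Unique L) where

  private
    H = graph 1≤T below unique

    column : ∀ (f : Arc T → ℕ) → at (map (f ∘ toArc) (edges H)) ≡ at (reverse (map f L))
    column f = cong at (trans (map-∘ (edges H))
        (trans (cong (map f) (map-toArc-graph 1≤T below unique)) (reverse-map f L)))

    stored : ∀ (f : Arc T → ℕ) {a} → Stored a (map f L) → ∀ j → j < ∣ℰ∣ H →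
        a j ≡ at (map (f ∘ toArc) (edges H)) j
    stored f st j j< = trans (st (subst (j <_)
        (trans (graph-∣ℰ∣ 1≤T below unique) (sym (length-map f L))) j<))
        (sym (cong (λ a → a j) (column f)))

  graph-encodes : ∀ {s k ℓ} → reg s nᵣ ≡ N → reg s τᵣ ≡ T → reg s kᵣ ≡ k → reg s ℓᵣ ≡ ℓ →
    Written (reg s mᵣ) (arr s lowers) (arr s uppers) (arr s times) L → s encodes (H , k , ℓ)
  graph-encodes {s} {k} {ℓ} n≡ τ≡ k≡ ℓ≡ (written m≡ st₀ st₁ st₂) = registers , arrays
    where
    registers : ∀ x → x < 5 → reg s x ≡ reg (load (H , k , ℓ)) x
    registers 0 _ = n≡
    registers 1 _ = τ≡
    registers 2 _ = k≡
    registers 3 _ = ℓ≡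
    registers 4 _ = trans m≡ (sym (graph-∣ℰ∣ 1≤T below unique))
    registers (suc (suc (suc (suc (suc x))))) (s≤s (s≤s (s≤s (s≤s (s≤s ())))))
    arrays : ∀ a j → a < 3 → j < ∣ℰ∣ H → arr s a j ≡ arr (load (H , k , ℓ)) a j
    arrays 0 j _ = stored proj₁ st₀ j
    arrays 1 j _ = stored (proj₁ ∘ proj₂) st₁ j
    arrays 2 j _ = stored (toℕ ∘ proj₂ ∘ proj₂) st₂ j
    arrays (suc (suc (suc a))) j (s≤s (s≤s (s≤s ())))

-- For k ≥ 2 one has k + 1 ≤ 2k ≤ k²; for k = 1 a second layer is required.
matching-fits : ∀ {k T} → 1 ≤ k → 1 ≤ T → ¬ (k ≡ 1 × T ≡ 1) → suc k ≤ k ^ 2 * T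
matching-fits {1} {1} _ _ exception = contradiction (refl , refl) exception
matching-fits {1} {suc (suc T)} _ _ _ = s≤s (s≤s z≤n)
matching-fits {K@(suc (suc _))} {T} _ 1≤T _ = begin
  1 + K       ≤⟨ +-monoˡ-≤ K {1} {K} (s≤s z≤n) ⟩
  K + K       ≡⟨ cong (K +_) (+-identityʳ K) ⟨
  2 * K       ≤⟨ *-monoˡ-≤ K {2} {K} (s≤s (s≤s z≤n)) ⟩
  K * K       ≡⟨ cong (K *_) (*-identityʳ K) ⟨
  K ^ 2       ≤⟨ m≤m*n (K ^ 2) T ⦃ >-nonZero 1≤T ⦄ ⟩
  K ^ 2 * T   ∎
  where open ≤-Reasoning

double-≤ : ∀ {a} k T → a ≤ k ^ 2 * T → a + a ≤ 2 * k ^ 2 * T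
double-≤ {a} k T a≤ = begin
  a + a                     ≤⟨ +-mono-≤ a≤ a≤ ⟩
  k ^ 2 * T + k ^ 2 * T     ≡⟨ cong (k ^ 2 * T +_) (+-identityʳ (k ^ 2 * T)) ⟨
  2 * (k ^ 2 * T)           ≡⟨ *-assoc 2 (k ^ 2) T ⟨
  2 * k ^ 2 * T             ∎
  where open ≤-Reasoning

-- Correctness and running time of the whole program

module _ (G : TemporalGraph) (k ℓ : ℕ) (1≤k : 1 ≤ k) where

  private
    E = edges G
    m = ∣ℰ∣ G
    cap = k ∸ (k ∸ (m + (m + m)))
    limit = τ G * (cap * cap)
    B = ∣V∣ G ^ 2 * τ G + 1

  1≤B : 1 ≤ B
  1≤B = m≤n+m 1 _

  m<B : m < B
  m<B = subst (m <_) (+-comm 1 _) (s≤s (∣ℰ∣≤ G))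

  -- Squaring the cap and writing the matching may take up to 3m rounds, the origin of the factor 3
  -- in `rate`.
  <3B : ∀ {i} → i ≤ m + (m + m) → i < 3 * B
  <3B i≤ = ≤-trans (s≤s i≤) (≤-trans (+-mono-≤ m<B (+-mono-≤ (<⇒≤ m<B) (<⇒≤ m<B)))
      (≤-reflexive (cong (λ c → B + (B + c)) (sym (+-identityʳ B)))))

  B≤3B : B ≤ 3 * B
  B≤3B = m≤m+n B _

  τ<B : 0 < m → τ G < B
  τ<B 0<m = subst (τ G <_) (+-comm 1 _) (s≤s (pos (∣V∣ G ^ 2) (≤-trans 0<m (∣ℰ∣≤ G))))
    where
    pos : ∀ c → 0 < c * τ G → τ G ≤ c * τ G
    pos (suc c) _ = m≤m+n (τ G) _

  cap≤k : cap ≤ k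
  cap≤k = m∸n≤m k (k ∸ (m + (m + m)))

  cap≤3m : cap ≤ m + (m + m)
  cap≤3m with ≤-total k (m + (m + m))
  ... | inj₁ k≤ = ≤-trans cap≤k k≤
  ... | inj₂ ≤k = ≤-reflexive (m∸[m∸n]≡n ≤k)

  Squaring : ℕ → Store → Set
  Squaring i s = Inputs G k ℓ s × arr s ≡ arr (load (G , k , ℓ)) × reg s capᵣ ≡ cap
    × (reg s limitᵣ ≡ 0 × reg s accᵣ ≡ 0 × reg s sizeᵣ ≡ 0 × reg s nextᵣ ≡ 0) × reg s iᵣ ≡ i
        × reg s squareᵣ ≡ i * cap

  square-step : ∀ {i s} → i < cap → Squaring i s → Holds (var iᵣ ≺ var capᵣ) s ×
    Exec (rate squareBody) squareBody (Squaring (suc i)) s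
  square-step {i} {s} i< (inputs , arrs , cap≡ , zeros , i≡ , sq≡) =
      subst₂ _<_ (sym i≡) (sym cap≡) i<
    , wp-sound squareBody {Q = Squaring (suc i)} {s = s}
        (inputs , arrs , cap≡ , zeros , cong suc i≡ , cong₂ _+_ cap≡ sq≡)

  Tabulating : ℕ → Store → Set
  Tabulating j s = Inputs G k ℓ s
    × (arr s lowers ≡ at (map lower E) × arr s uppers ≡ at (map upper E)
        × arr s times ≡ at (map time E))
    × (arr s table ≡ (λ _ → 0) × arr s idents ≡ (λ _ → 0))
    × (reg s sizeᵣ ≡ 0 × reg s nextᵣ ≡ 0) × reg s squareᵣ ≡ cap * cap
    × reg s iᵣ ≡ j × reg s accᵣ ≡ j * n G × reg s limitᵣ ≡ j * (cap * cap)
        × Agree j (arr s rows) (_* n G)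

  tabulate-step : ∀ {j s} → j < τ G → Tabulating j s →
      Holds (var iᵣ ≺ var τᵣ) s × Exec (rate rowsBody) rowsBody (Tabulating (suc j)) s
  tabulate-step {j} {s} j< (inputs@(n≡ , τ≡ , _) , sources , blank , zeros , sq≡ , i≡ , acc≡
      , limit≡ , rows≡) =
    subst₂ _<_ (sym i≡) (sym τ≡) j<
    , wp-sound rowsBody {Q = Tabulating (suc j)} {s = s}
        (inputs , sources , blank , zeros , sq≡ , cong suc i≡ , cong₂ _+_ n≡ acc≡
            , cong₂ _+_ sq≡ limit≡ , agree-extend rows≡ i≡ acc≡)

  Counting : List (Edge (n G) (τ G)) → Store → Set
  Counting P s = Env G k ℓ limit s
    × (arr s lowers ≡ at (map lower E) × arr s uppers ≡ at (map upper E)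
        × arr s times ≡ at (map time E))
    × (arr s idents ≡ (λ _ → 0) × reg s sizeᵣ ≡ 0 × reg s nextᵣ ≡ 0) × reg s iᵣ ≡ length P
    × (Agree (length P) (arr s lowers′) (at (map lower E))
        × Agree (length P) (arr s uppers′) (at (map upper E))
        × Agree (length P) (arr s times′) (at (map time E)))
    × (∀ t v → arr s table (key t v) ≡ degree t v P)

  count-step : ∀ {P e R s} → P ʳ++ (e ∷ R) ≡ E → Counting P s →
      Holds (var iᵣ ≺ var mᵣ) s × Exec (rate countBody) countBody (Counting (e ∷ P)) s
  count-step {P} {e@(u , w , t)} {R} {s} P≡
      (env@((_ , _ , _ , _ , m≡) , rows≡ , _) , sources@(lo≡ , up≡ , ti≡) , zeros , i≡
      , (lo , up , ti) , degrees) =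
    subst₂ _<_ (sym i≡) (sym m≡) (P<m G k ℓ limit {P} {R} P≡)
    , wp-sound countBody {Q = Counting (e ∷ P)} {s = s}
        ( env , sources , zeros , cong suc i≡
        , ( agree-extend lo i≡ (cong₂ (λ a i → a i) lo≡ i≡)
            , agree-extend up i≡ (cong₂ (λ a i → a i) up≡ i≡)
          , agree-extend ti i≡ (cong₂ (λ a i → a i) ti≡ i≡))
        , degree-bump (u≢w G k ℓ limit {P} {R} P≡) (addressed lower refl lo≡)
            (addressed upper refl up≡) degrees)
    where
    entry : ∀ (f : Edge (n G) (τ G) → ℕ) {a} → a ≡ at (map f E) → a (reg s iᵣ) ≡ f e
    entry f a≡ = current G k ℓ limit {P} {R} P≡ f (λ {j} _ → cong (λ a → a j) a≡) i≡
    addressed : ∀ (f : Edge (n G) (τ G) → ℕ) {v : Fin (n G)} {a} → f e ≡ toℕ v → a ≡ at (map f E) →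
      arr s rows (arr s times (reg s iᵣ)) + a (reg s iᵣ) ≡ key t v
    addressed f {v} f≡ a≡ = trans (cong₂ _+_
        (trans (cong (arr s rows) (entry time ti≡)) (rows≡ (Fin.toℕ<n t))) (trans (entry f a≡) f≡))
        (key≡ t v)

  Overflowing : ℕ → Store → Set
  Overflowing c s = (reg s τᵣ ≡ τ G × reg s kᵣ ≡ k × reg s ℓᵣ ≡ ℓ) × reg s nextᵣ ≡ c + c
    × Written (reg s sizeᵣ) (arr s lowers) (arr s uppers) (arr s times)
        (matching (Fin.fromℕ< (τ-positive G)) c)

  overflowing-size : ∀ {c s} → Overflowing c s → reg s sizeᵣ ≡ c
  overflowing-size {c} (_ , _ , written size _ _ _) = trans size (length-applyDownFrom _ c)

  overflow-step : ∀ {c s} → c < suc k → Overflowing c s →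
      Holds (var sizeᵣ ≺ lit 1 ⊕ var kᵣ) s
      × Exec (rate overflowBody) overflowBody (Overflowing (suc c)) s
  overflow-step {c} {s} c< inv@(inputs@(_ , k≡ , _) , next≡ , wr) =
    subst₂ _<_ (sym (overflowing-size {c} {s} inv)) (cong suc (sym k≡)) c<
    , wp-sound overflowBody {Q = Overflowing (suc c)} {s = s}
        ( inputs , trans (cong (2 +_) next≡) (cong suc (sym (+-suc c c)))
        , written-push wr next≡ (cong suc next≡) (sym (Fin.toℕ-fromℕ< (τ-positive G))))

  Accepted : TemporalGraph → Set
  Accepted G′ = Equivalent (G , k , ℓ) (G′ , k , ℓ)
    × (¬ (k ≡ 1 × τ G ≡ 1) → ∣V∣ G′ ≤ 2 * k ^ 2 * τ G × ∣ℰ∣ G′ ≤ k ^ 2 * τ G)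

  Result : Store → Set
  Result s = ∃[ G′ ] s encodes (G′ , k , ℓ) × Accepted G′

  record Solved (s : Store) : Set where
    field
      {next}   : ℕ
      {L}      : List (Arc (τ G))
      below    : All (Below next) L
      unique   : Unique L
      inputs   : reg s τᵣ ≡ τ G × reg s kᵣ ≡ k × reg s ℓᵣ ≡ ℓ
      next≡    : reg s nextᵣ ≡ next
      printed  : Written (reg s sizeᵣ) (arr s lowers) (arr s uppers) (arr s times) L
      accepted : Accepted (graph (τ-positive G) below unique)

  publish : ∀ {s} → Solved s → Exec (rate (nᵣ ≔ var nextᵣ ⨾ mᵣ ≔ var sizeᵣ) * B)
      (nᵣ ≔ var nextᵣ ⨾ mᵣ ≔ var sizeᵣ) Result s
  publish {s} sol = straight 1≤B (nᵣ ≔ var nextᵣ ⨾ mᵣ ≔ var sizeᵣ) {Q = Result} {s = s}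
    (_ , graph-encodes (τ-positive G) below unique next≡ (proj₁ inputs) (proj₁ (proj₂ inputs))
        (proj₂ (proj₂ inputs)) printed , accepted)
    where open Solved sol

  Kernelized : Store → Set
  Kernelized s = ∃[ P ] reverse P ≡ E × Progress G k ℓ limit P s

  -- Capping can only lower the limit, so an output within it obeys the bound for `k` itself.
  accept-kernel : ∀ {s} → Kernelized s → ¬ Holds (var limitᵣ ≺ var sizeᵣ) s → Solved s
  accept-kernel {s} (P , P≡ , ((_ , τ≡ , k≡ , ℓ≡ , _) , _ , limit≡) , _ , _
      , output {out = out} I pr _ next≤) fits = record
    { below = Kernel.below K ; unique = Kernel.unique K ; inputs = τ≡ , k≡ , ℓ≡ ; next≡ = refl
    ; printed = pr
    ; accepted = Kernel.equivalent K ℓ , λ _ →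
        ≤-trans next≤ (double-≤ k (τ G) size≤) , ≤-trans (≤-reflexive edges≡) size≤ }
    where
    K : Kernel G k (reg s nextᵣ) (map proj₁ out)
    K = finished G k I P≡
    edges≡ : ∣ℰ∣ (Kernel.kernel K) ≡ length out
    edges≡ = trans (graph-∣ℰ∣ (τ-positive G) (Kernel.below K) (Kernel.unique K))
        (length-map proj₁ out)
    size≤ : length out ≤ k ^ 2 * τ G
    size≤ = begin
      length out         ≡⟨ trans (sym (length-map proj₁ out)) (sym (Written.size pr)) ⟩
      reg s sizeᵣ        ≤⟨ ≮⇒≥ fits ⟩
      reg s limitᵣ       ≡⟨ limit≡ ⟩
      τ G * (cap * cap)  ≤⟨ *-monoʳ-≤ (τ G) (*-mono-≤ cap≤k cap≤k) ⟩
      τ G * (k * k)      ≡⟨ *-comm (τ G) (k * k) ⟩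
      k * k * τ G        ≡⟨ cong (λ c → k * c * τ G) (*-identityʳ k) ⟨
      k ^ 2 * τ G        ∎
      where open ≤-Reasoning

  reject : ∀ {s} → Kernelized s → Holds (var limitᵣ ≺ var sizeᵣ) s → 0 < m →
    Exec (rate overflow * B) overflow Solved s
  reject {s} (P , P≡ , ((_ , τ≡ , k≡ , ℓ≡ , _) , _ , limit≡) , _ , _
      , output {out = out} I pr few≤ _) over 0<m =
    _then_ 1≤B {P = sizeᵣ ≔ lit 0} {R = λ s′ → s′ ≡ s₁}
        (straight 1≤B (sizeᵣ ≔ lit 0) {Q = _≡ s₁} {s = s} refl) λ where
      refl → _then_ 1≤B {P = nextᵣ ≔ lit 0} {R = Overflowing 0}
          (straight 1≤B (nextᵣ ≔ lit 0) {Q = Overflowing 0} {s = s₁}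
        ((τ≡ , k≡ , ℓ≡) , refl , written refl (λ ()) (λ ()) (λ ())))
        λ {s₂} start → weaken′ (fromZero 1≤B {b = var sizeᵣ ≺ lit 1 ⊕ var kᵣ}
            {P = overflowBody} {s = s₂} Overflowing (suc k) (<3B k<3m)
          overflow-step (λ {s} inv@((_ , k≡ , _) , _) →
              ≤⇒≯ (≤-reflexive (sym (trans (overflowing-size {suc k} {s} inv)
              (cong suc (sym k≡)))))) start)
    where
    s₁ = store (reg s [ sizeᵣ ↦ 0 ]) (arr s)
    size≡ : reg s sizeᵣ ≡ length out
    size≡ = trans (Written.size pr) (length-map proj₁ out)
    lengthP : length P ≡ m
    lengthP = trans (sym (length-reverse P)) (cong length P≡)
    size≤3m : reg s sizeᵣ ≤ m + (m + m)
    size≤3m = ≤-trans (≤-reflexive size≡)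
        (≤-trans few≤ (≤-reflexive (trans (cong (_* 3) lengthP)
        (trans (*-comm m 3) (cong (λ c → m + (m + c)) (+-identityʳ m))))))
    limit< : limit < reg s sizeᵣ
    limit< = subst (_< reg s sizeᵣ) limit≡ over
    -- Otherwise `cap` would be 3m and the limit at least (3m)², while at most 3m edges have been
    -- written.
    k<3m : k < m + (m + m)
    k<3m with k <? m + (m + m)
    ... | yes k< = k<
    ... | no  k≮ = contradiction limit<
          (≤⇒≯ (≤-trans size≤3m (subst (λ c → m + (m + m) ≤ τ G * (c * c))
          (sym (m∸[m∸n]≡n (≮⇒≥ k≮)))
                     (≤-trans (m≤m*n 3m 3m ⦃ nz ⦄) (m≤n*m (3m * 3m)
                         (τ G) ⦃ >-nonZero (τ-positive G) ⦄)))))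
      where
      3m = m + (m + m)
      nz : NonZero 3m
      nz = >-nonZero (≤-trans 0<m (m≤m+n m _))
    cap≡k : cap ≡ k
    cap≡k = cong (k ∸_) (m≤n⇒m∸n≡0 (<⇒≤ k<3m))
    -- Since the cap was not active, the exceeded limit is exactly k²τ.
    no-solution : ¬ YesInstance (G , k , ℓ)
    no-solution sol = contradiction (sparse G k I P≡ 1≤k sol) (<⇒≱ (begin-strict
      k ^ 2 * τ G         ≡⟨ cong (λ c → k * c * τ G) (*-identityʳ k) ⟩
      k * k * τ G         ≡⟨ *-comm (k * k) (τ G) ⟩
      τ G * (k * k)       ≡⟨ cong (λ c → τ G * (c * c)) cap≡k ⟨
      limit               <⟨ limit< ⟩
      reg s sizeᵣ         ≡⟨ size≡ ⟩
      length out          ∎))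
      where open ≤-Reasoning
    t₀ = Fin.fromℕ< (τ-positive G)
    weaken′ : ∀ {B P s} → Exec B P (Overflowing (suc k)) s → Exec B P Solved s
    weaken′ ex = weaken ex λ {s} (inputs , next≡ , wr) → record
      { below = matching-below t₀ (suc k) ; unique = matching-unique t₀ (suc k)
      ; inputs = inputs ; next≡ = next≡ ; printed = wr
      ; accepted = inj₂ (no-solution , λ sol →
          contradiction (matching-no (τ-positive G) t₀ (suc k) sol) (<⇒≱ (n<1+n k)))
                 , λ exception → let fits = matching-fits 1≤k (τ-positive G) exception in
                   double-≤ k (τ G) fits
                   , ≤-trans (≤-reflexive (trans (graph-∣ℰ∣ (τ-positive G)
                       (matching-below t₀ (suc k)) (matching-unique t₀ (suc k)))
                       (length-applyDownFrom _ (suc k)))) fits }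

  tabulate-exec : ∀ {s} → 0 < m → Tabulating 0 s →
      Exec (rate computeRows * B) computeRows (Tabulating (τ G)) s
  tabulate-exec {s} 0<m = fromZero 1≤B {b = var iᵣ ≺ var τᵣ} {P = rowsBody} {s = s} Tabulating (τ G)
      (<-≤-trans (τ<B 0<m) B≤3B) tabulate-step
    λ (( _ , τ≡ , _) , _ , _ , _ , _ , i≡ , _) → ≤⇒≯ (≤-reflexive (trans τ≡ (sym i≡)))

  square-exec : ∀ {s} → Squaring 0 s → Exec (rate computeSquare * B) computeSquare (Squaring cap) s
  square-exec {s} = fromZero 1≤B {b = var iᵣ ≺ var capᵣ} {P = squareBody} {s = s} Squaring cap
      (<3B cap≤3m) square-step
    λ (_ , _ , cap≡ , _ , i≡ , _) → ≤⇒≯ (≤-reflexive (trans cap≡ (sym i≡)))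

  reset-square : ∀ {s} → Squaring cap s → Exec (rate reset * B) reset (Tabulating 0) s
  reset-square {s} (inputs , arrs , _ , (limit≡ , acc≡ , zeros) , _ , sq≡) =
      straight 1≤B reset {Q = Tabulating 0} {s = s}
    (inputs , (cong (λ a → a lowers) arrs , cong (λ a → a uppers) arrs , cong (λ a → a times) arrs)
    , (cong (λ a → a table) arrs , cong (λ a → a idents) arrs) , zeros , sq≡ , refl , acc≡ , limit≡
        , λ ())

  reset-rows : ∀ {s} → Tabulating (τ G) s → Exec (rate reset * B) reset (Counting []) s
  reset-rows {s} (inputs , sources , (table≡ , idents≡) , (size≡ , next≡) , _ , _ , _ , limit≡
      , rows≡) = straight 1≤B reset {Q = Counting []} {s = s}
    ((inputs , rows≡ , limit≡) , sources , (idents≡ , size≡ , next≡) , refl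
        , ((λ ()) , (λ ()) , (λ ()))
    , λ t v → trans (cong (λ a → a (key t v)) table≡) (sym (count-[] (incident? t v))))

  length-reversed : ∀ (P : List (Edge (n G) (τ G))) → reverse P ≡ E → length P ≡ m
  length-reversed P P≡ = trans (sym (length-reverse P)) (cong length P≡)

  count-exec : ∀ {s} → Counting [] s →
      Exec (rate copyAndCount * B) copyAndCount (λ s → ∃[ P ] reverse P ≡ E × Counting P s) s
  count-exec {s} = foreach 1≤B {b = var iᵣ ≺ var mᵣ} {P = countBody} {s = s} Counting E
      (<-≤-trans m<B B≤3B)
    (λ {P} {e} {R} {s} → count-step {P} {e} {R} {s})
    λ {P} P≡ (((_ , _ , _ , _ , m≡) , _) , _ , _ , i≡ , _) →
        ≤⇒≯ (≤-reflexive (trans m≡ (sym (trans i≡ (length-reversed P P≡)))))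

  reset-count : ∀ {s} → (∃[ P ] reverse P ≡ E × Counting P s) →
      Exec (rate reset * B) reset (Progress G k ℓ limit []) s
  reset-count {s} (P , P≡ , env , _ , (idents≡ , size≡ , next≡) , _ , (lo , up , ti) , degrees) =
      straight 1≤B reset {Q = Progress G k ℓ limit []} {s = s}
    (env , (whole lo , whole up , whole ti) , refl
    , output (subst₂ (λ ident N → Partial G k (arr s table) ident N (λ _ → 0) [] []) (sym idents≡)
        (sym next≡)
               (start G k λ t v → trans (degrees t v)
                   (trans (sym (count-reverse (incident? t v) P)) (cong (degree t v) P≡))))
             (written size≡ (λ ()) (λ ()) (λ ())) z≤n (≤-reflexive next≡))
    where
    whole : ∀ {a b} → Agree (length P) a b → Agree m a b
    whole {a} {b} = subst (λ M → Agree M a b) (length-reversed P P≡)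

  kernelize-exec : ∀ {s} → Progress G k ℓ limit [] s →
      Exec (rate kernelize * B) kernelize Kernelized s
  kernelize-exec {s} = foreach 1≤B {b = var iᵣ ≺ var mᵣ} {P = process} {s = s}
      (Progress G k ℓ limit) E (<-≤-trans m<B B≤3B)
    (λ { {P} {e} {R} {s} P≡ progress@(((_ , _ , _ , _ , m≡) , _) , _ , i≡ , _) →
       subst₂ _<_ (sym i≡) (sym m≡) (P<m G k ℓ limit {P} {R} P≡)
           , process-exec G k ℓ limit {P} {R} P≡ {s} progress })
    λ {P} P≡ (((_ , _ , _ , _ , m≡) , _) , _ , i≡ , _) →
        ≤⇒≯ (≤-reflexive (trans m≡ (sym (trans i≡ (length-reversed P P≡)))))

  guard-exec : ∀ {s} → 0 < m → Kernelized s → Exec (rate guard * B) guard Solved s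
  guard-exec {s} 0<m kd = branch 1≤B {b = var limitᵣ ≺ var sizeᵣ} {P = overflow} {P′ = skip}
      {Q = Solved} {s = s}
    (λ over → reject {s} kd over 0<m)
        (λ fits → straight 1≤B skip {Q = Solved} {s = s} (accept-kernel {s} kd fits))

  program-exec : Exec (rate program * B) program Result (load (G , k , ℓ))
  program-exec = branch 1≤B {b = lit 0 ≺ var mᵣ} {Q = Result} {s = s₀} nonempty empty
    where
    s₀ = load (G , k , ℓ)
    infixr 3 _▸_
    _▸_ : ∀ {P P′ Q R s} → Exec (rate P * B) P R s → (∀ {s} → R s → Exec (rate P′ * B) P′ Q s) →
        Exec (rate (P ⨾ P′) * B) (P ⨾ P′) Q s
    _▸_ {P} {P′} {Q} {R} {s} = _then_ 1≤B {P} {P′} {Q} {R} {s}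
    nonempty : 0 < m → Exec (rate main * B) main Result s₀
    nonempty 0<m = straight 1≤B computeCap {Q = Squaring 0} {s = s₀}
        ((refl , refl , refl , refl , refl) , refl , refl , (refl , refl , refl , refl) , refl
        , refl)
      ▸ λ {s} q → square-exec {s} q ▸ λ {s} q → reset-square {s} q
      ▸ λ {s} q → tabulate-exec {s} 0<m q ▸ λ {s} q → reset-rows {s} q
      ▸ λ {s} q → count-exec {s} q ▸ λ {s} q → reset-count {s} q
      ▸ λ {s} q → kernelize-exec {s} q
      ▸ λ {s} q → guard-exec {s} 0<m q
      ▸ λ {s} q → publish {s} q
    empty : ¬ 0 < m → Exec (rate (nᵣ ≔ lit 0) * B) (nᵣ ≔ lit 0) Result s₀
    empty ≮m = straight 1≤B (nᵣ ≔ lit 0) {Q = Result} {s = s₀}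
      ( Kernel.kernel K
      , graph-encodes (τ-positive G) (Kernel.below K) (Kernel.unique K) refl refl refl refl
          (written m≡0 (λ ()) (λ ()) (λ ()))
      , Kernel.equivalent K ℓ , λ _ → z≤n
          , ≤-trans (≤-reflexive (graph-∣ℰ∣ (τ-positive G) (Kernel.below K) (Kernel.unique K))) z≤n)
      where
      m≡0 : m ≡ 0
      m≡0 = n≤0⇒n≡0 (≮⇒≥ ≮m)
      length≡0 : ∀ (L : List (Edge (n G) (τ G))) → length L ≡ 0 → [] ≡ L
      length≡0 [] _ = refl
      E≡[] : [] ≡ E
      E≡[] = length≡0 E m≡0
      -- Without edges the initial invariant, for the zero table, is already the final one.
      K : Kernel G k 0 []
      K = finished G k (start G k {D = λ _ → 0} λ t v →
          trans (sym (count-[] (incident? t v))) (cong (degree t v) E≡[])) E≡[]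

theorem38 :
    ∃[ P ] ∃[ C ]
      ((G : TemporalGraph) (k ℓ : ℕ) → 1 ≤ k →
        ∃[ G′ ]
          P maps (G , k , ℓ) to (G′ , k , ℓ) within (C * (∣V∣ G ^ 2 * τ G + 1))
          × Equivalent (G , k , ℓ) (G′ , k , ℓ)
          × (¬ (k ≡ 1 × τ G ≡ 1) →
               ∣V∣ G′ ≤ 2 * k ^ 2 * τ G × ∣ℰ∣ G′ ≤ k ^ 2 * τ G))
-- `rate program` is computed from the program text alone, so it is a constant independent of the
-- instance.
theorem38 = program , rate program , λ G k ℓ 1≤k →
  let T , s , ⇓P , T≤ , G′ , encodes , equivalent , bounds = program-exec G k ℓ 1≤k
  in G′ , (T , s , ⇓P , encodes , T≤) , equivalent , bounds
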